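{- Let $k\ge 2$ be an integer. Then, as $n\to\infty$, $$p_k(0,2,n)\sim p_k(1,2,n)\sim \frac{p_k(n)}{2},$$ and, for all sufficiently large $n$, $$p_k(0,2,n)>p_k(1,2,n)\ \text{ if } n \text{ is even},\qquad p_k(0,2,n)<p_k(1,2,n)\ \text{ if } n \text{ is odd}.$$
   Context: A partition of a positive integer $n$ is a non-increasing sequence of positive integers (parts) summing to $n$. For an integer $k\ge1$, $p_k(n)$ denotes the number of partitions of $n$ all of whose parts are perfect $k$th powers $m^k$ ($m\in\mathbb N$), with $p_k(0)=1$. For integers $0\le a<m$, $p_k(a,m,n)$ denotes the number of partitions of $n$ into perfect $k$th powers whose number of parts is congruent to $a$ modulo $m$. -}

module Defs where

open import Data.Bool using (Bool; true; false; _∧_)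
open import Data.Nat using (ℕ; zero; suc; _∸_; _^_; _%_; _≡ᵇ_; _⊓_)
open import Data.List using (List; []; _∷_; [_]; map; concatMap; upTo; filterᵇ; length; all; any)
open import Data.Integer using (+_)
open import Data.Rational using (ℚ; _/_; _-_; _*_; ∣_∣; _≤_; _<_; 0ℚ; ½)
open import Data.Product using (∃-syntax)
import Data.Nat as N

-- x is a perfect k-th power m^k with m ∈ ℕ, m ≥ 1 (for x ≥ 1 any such m satisfies m ≤ x)
isKthPower : ℕ → ℕ → Bool
isKthPower k x = any (λ m → (m ^ k) ≡ᵇ x) (map suc (upTo x))

-- all non-increasing lists of positive integers summing to n whose parts are ≤ mx;
-- the first argument is fuel (n steps suffice since every part is ≥ 1)
partsBounded : ℕ → ℕ → ℕ → List (List ℕ)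
partsBounded _ zero _ = [ [] ]
partsBounded zero (suc n) _ = []
partsBounded (suc f) (suc n) mx =
  concatMap (λ j → map (j ∷_) (partsBounded f (suc n ∸ j) j))
            (map suc (upTo (suc n ⊓ mx)))

partitions : ℕ → List (List ℕ)
partitions n = partsBounded n n n

p : ℕ → ℕ → ℕ
p k n = length (filterᵇ (all (isKthPower k)) (partitions n))

pMod : ℕ → (a m : ℕ) → .{{_ : N.NonZero m}} → ℕ → ℕ
pMod k a m n =
  length (filterᵇ (λ λs → all (isKthPower k) λs ∧ ((length λs % m) ≡ᵇ a)) (partitions n))

toℚ : ℕ → ℚ
toℚ n = (+ n) / 1

_∼_ : (ℕ → ℚ) → (ℕ → ℚ) → Set
f ∼ g = ∀ (ε : ℚ) → 0ℚ < ε → ∃[ N ] (∀ n → N N.≤ n → ∣ f n - g n ∣ ≤ ε * ∣ g n ∣)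

{-# OPTIONS --safe #-}
module Submission where

-- Let D(n) = (-1)^n (p_k(0,2,n) - p_k(1,2,n)). Since a part m^k contributes the factor -(-1)^m to
-- (-1)^(n + number of parts), Σ D(n) q^n is the product of 1/(1 - q^(m^k)) over odd m and 1/(1 + q^(m^k)) over even m. Writing
-- 1/(1 + y) = (1 - y)/(1 - y²) and regrouping, this equals the product over all m ≥ 1 of the polynomials
-- 1 + q^e + … + q^(e (L-1)), with e = m^k, L = 2^k for odd m and e = 2m^k, L = 2^(k-1) for even m. Hence D(n) ≥ 0, and
-- D(n) ≥ 1 as soon as n is a sum of multiples i e with i < L.
--
-- Every large n is such a sum. Thue–Morse signed sums of 2^k consecutive k-th powers are constant, equal to C say.
-- Taking them at the scales 2^a x ≤ l < 2^(a+1) x, the even m = 2l represent arbitrarily long arithmetic progressions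
-- of step 2^(k+1) C. Odd m ≡ 1 modulo this step provide all residues, and the remaining odd m
-- extend the resulting interval to infinity.
--
-- For the asymptotics, D(n) is at most the number of partitions into odd k-th powers, which is o(p_k(n)): a largest part
-- (m+1)^k can be traded for m^k, a variable number of parts 2^k and parts 1, while the partitions
-- with bounded parts are outnumbered as soon as the part 2^k is allowed in addition.

-- Formal power series: shifts, binomial factors and geometric sums.

module Series where

  open import Data.Nat as ℕ using (ℕ; zero; suc; s≤s)
  import Data.Nat.Properties as ℕ
  open import Data.Integer using (ℤ; +_; 0ℤ; 1ℤ; _+_; _-_; -_; _*_; _≤_)
  open import Data.Integer.Properties
  open import Data.Integer.Tactic.RingSolver using (solve-∀)
  open import Data.Sum using (inj₁; inj₂)
  open import Relation.Binary.PropositionalEquality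

  -- Formal power series are coefficient sequences; sh a is multiplication by q^a.
  Ser : Set
  Ser = ℕ → ℤ

  δ : Ser
  δ zero = 1ℤ
  δ (suc _) = 0ℤ

  sh : ℕ → Ser → Ser
  sh zero f n = f n
  sh (suc a) f zero = 0ℤ
  sh (suc a) f (suc n) = sh a f n

  sh-cong : ∀ a {f g} n → (∀ i → i ℕ.≤ n → f i ≡ g i) → sh a f n ≡ sh a g n
  sh-cong zero n e = e n ℕ.≤-refl
  sh-cong (suc a) zero e = refl
  sh-cong (suc a) (suc n) e = sh-cong a n λ i i≤n → e i (ℕ.m≤n⇒m≤1+n i≤n)

  sh-cong-< : ∀ a {f g} n → 1 ℕ.≤ a → (∀ i → i ℕ.< n → f i ≡ g i) → sh a f n ≡ sh a g n
  sh-cong-< (suc a) zero _ e = refl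
  sh-cong-< (suc a) (suc n) _ e = sh-cong a n λ i i≤n → e i (s≤s i≤n)

  sh-mono : ∀ a {f g} n → (∀ i → i ℕ.≤ n → f i ≤ g i) → sh a f n ≤ sh a g n
  sh-mono zero n e = e n ℕ.≤-refl
  sh-mono (suc a) zero e = ≤-refl
  sh-mono (suc a) (suc n) e = sh-mono a n λ i i≤n → e i (ℕ.m≤n⇒m≤1+n i≤n)

  sh-mono-< : ∀ a {f g} n → 1 ℕ.≤ a → (∀ i → i ℕ.< n → f i ≤ g i) → sh a f n ≤ sh a g n
  sh-mono-< (suc a) zero _ e = ≤-refl
  sh-mono-< (suc a) (suc n) _ e = sh-mono a n λ i i≤n → e i (s≤s i≤n)

  sh-+ : ∀ a b f n → sh a (sh b f) n ≡ sh (a ℕ.+ b) f n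
  sh-+ zero b f n = refl
  sh-+ (suc a) b f zero = refl
  sh-+ (suc a) b f (suc n) = sh-+ a b f n

  sh-comm : ∀ a b f n → sh a (sh b f) n ≡ sh b (sh a f) n
  sh-comm a b f n = trans (sh-+ a b f n) (trans (cong (λ c → sh c f n) (ℕ.+-comm a b)) (sym (sh-+ b a f n)))

  sh-0 : ∀ a n → sh a (λ _ → 0ℤ) n ≡ 0ℤ
  sh-0 zero n = refl
  sh-0 (suc a) zero = refl
  sh-0 (suc a) (suc n) = sh-0 a n

  sh-add : ∀ a f g n → sh a (λ i → f i + g i) n ≡ sh a f n + sh a g n
  sh-add zero f g n = refl
  sh-add (suc a) f g zero = refl
  sh-add (suc a) f g (suc n) = sh-add a f g n

  sh-sub : ∀ a f g n → sh a (λ i → f i - g i) n ≡ sh a f n - sh a g n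
  sh-sub zero f g n = refl
  sh-sub (suc a) f g zero = refl
  sh-sub (suc a) f g (suc n) = sh-sub a f g n

  sh-* : ∀ a c f n → sh a (λ i → c * f i) n ≡ c * sh a f n
  sh-* zero c f n = refl
  sh-* (suc a) c f zero = sym (*-zeroʳ c)
  sh-* (suc a) c f (suc n) = sh-* a c f n

  sh-nonNeg : ∀ a f n → (∀ i → i ℕ.≤ n → 0ℤ ≤ f i) → 0ℤ ≤ sh a f n
  sh-nonNeg a f n h = subst (_≤ sh a f n) (sh-0 a n) (sh-mono a n h)

  sh-big : ∀ a f n → n ℕ.< a → sh a f n ≡ 0ℤ
  sh-big (suc a) f zero _ = refl
  sh-big (suc a) f (suc n) (s≤s n<a) = sh-big a f n n<a

  sh-small : ∀ a f n → sh a f (a ℕ.+ n) ≡ f n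
  sh-small zero f n = refl
  sh-small (suc a) f n = sh-small a f n

  sh-∸ : ∀ a f n → a ℕ.≤ n → sh a f n ≡ f (n ℕ.∸ a)
  sh-∸ a f n a≤n = trans (cong (sh a f) (sym (ℕ.m+[n∸m]≡n a≤n))) (sh-small a f (n ℕ.∸ a))

  -- B c a is multiplication by 1 - c q^a.
  B : ℤ → ℕ → Ser → Ser
  B c a f n = f n - c * sh a f n

  B-cong : ∀ c a {f g} n → (∀ i → i ℕ.≤ n → f i ≡ g i) → B c a f n ≡ B c a g n
  B-cong c a n e = cong₂ (λ x y → x - c * y) (e n ℕ.≤-refl) (sh-cong a n e)

  B-cong′ : ∀ c a {f g} → f ≗ g → B c a f ≗ B c a g
  B-cong′ c a e n = B-cong c a n (λ i _ → e i)

  sh-B : ∀ b c a f n → sh b (B c a f) n ≡ B c a (sh b f) n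
  sh-B b c a f n = trans (sh-sub b f (λ i → c * sh a f i) n)
    (cong (λ x → sh b f n - x) (trans (sh-* b c (sh a f) n) (cong (c *_) (sh-comm b a f n))))

  B-comm : ∀ c a d b f → B c a (B d b f) ≗ B d b (B c a f)
  B-comm c a d b f n = begin
    (f n - d * sh b f n) - c * sh a (B d b f) n
      ≡⟨ cong (λ x → (f n - d * sh b f n) - c * x) (sh-B a d b f n) ⟩
    (f n - d * sh b f n) - c * (sh a f n - d * sh b (sh a f) n)
      ≡⟨ cong (λ x → (f n - d * sh b f n) - c * (sh a f n - d * x)) (sh-comm b a f n) ⟩
    (f n - d * sh b f n) - c * (sh a f n - d * sh a (sh b f) n)
      ≡⟨ lem (f n) c d (sh a f n) (sh b f n) (sh a (sh b f) n) ⟩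
    (f n - c * sh a f n) - d * (sh b f n - c * sh a (sh b f) n)
      ≡⟨ cong (λ x → (f n - c * sh a f n) - d * x) (sh-B b c a f n) ⟨
    B d b (B c a f) n ∎
    where
    open ≡-Reasoning
    lem : ∀ x c d s t u → (x - d * t) - c * (s - d * u) ≡ (x - c * s) - d * (t - c * u)
    lem = solve-∀

  private
    cancel : ∀ {x y z} → x - z ≡ y - z → x ≡ y
    cancel {x} {y} {z} e = trans (sym (lem x z)) (trans (cong (_+ z) e) (lem y z))
      where
      lem : ∀ x z → (x - z) + z ≡ x
      lem = solve-∀

  -- For a ≥ 1 each coefficient of `f` is determined by that of the product and by lower
  -- coefficients of `f`. This cancellation replaces division throughout: identities between
  -- quotients are proved after clearing denominators. The bound `N` admits products that agree only
  -- in low degrees.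
  B-inj : ∀ c a {f g} N → 1 ℕ.≤ a → (∀ i → i ℕ.≤ N → B c a f i ≡ B c a g i) →
          ∀ i → i ℕ.≤ N → f i ≡ g i
  B-inj c a {f} {g} N 1≤a e i i≤N = below (suc i) i ℕ.≤-refl i≤N
    where
    -- `t` only bounds `i`; it makes the course-of-values induction structural.
    below : ∀ t i → i ℕ.< t → i ℕ.≤ N → f i ≡ g i
    below (suc t) i (s≤s i≤t) i≤N = cancel {z = c * sh a f i} (trans (e i i≤N)
      (cong (λ x → g i - c * x) (sym (sh-cong-< a i 1≤a λ j j<i →
        below t j (ℕ.≤-trans j<i i≤t) (ℕ.≤-trans (ℕ.<⇒≤ j<i) i≤N)))))

  -- Multiplication by 1 + q^e + … + q^(e(l-1)).
  S : ℕ → ℕ → Ser → Ser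
  S e zero f n = 0ℤ
  S e (suc l) f n = S e l f n + sh (l ℕ.* e) f n

  -- The finite geometric sum, by which (1 - q^(l e))/(1 - q^e) becomes a polynomial with
  -- nonnegative coefficients.
  S-telescope : ∀ e l f → B 1ℤ e (S e l f) ≗ B 1ℤ (l ℕ.* e) f
  S-telescope e zero f n = begin
    0ℤ - 1ℤ * sh e (λ _ → 0ℤ) n ≡⟨ cong (λ x → 0ℤ - 1ℤ * x) (sh-0 e n) ⟩
    0ℤ                          ≡⟨ lem (f n) ⟨
    f n - 1ℤ * f n              ∎
    where
    open ≡-Reasoning
    lem : ∀ x → x - 1ℤ * x ≡ 0ℤ
    lem = solve-∀
  S-telescope e (suc l) f n = begin
    (S e l f n + u) - 1ℤ * sh e (S e (suc l) f) n
      ≡⟨ cong (λ x → (S e l f n + u) - 1ℤ * x) (sh-add e (S e l f) (sh (l ℕ.* e) f) n) ⟩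
    (S e l f n + u) - 1ℤ * (sh e (S e l f) n + sh e (sh (l ℕ.* e) f) n)
      ≡⟨ lem₁ (S e l f n) u (sh e (S e l f) n) (sh e (sh (l ℕ.* e) f) n) ⟩
    (B 1ℤ e (S e l f) n + u) - 1ℤ * sh e (sh (l ℕ.* e) f) n
      ≡⟨ cong₂ (λ x y → (x + u) - 1ℤ * y) (S-telescope e l f n) (sh-+ e (l ℕ.* e) f n) ⟩
    ((f n - 1ℤ * u) + u) - 1ℤ * sh (suc l ℕ.* e) f n
      ≡⟨ lem₂ (f n) u (sh (suc l ℕ.* e) f n) ⟩
    f n - 1ℤ * sh (suc l ℕ.* e) f n ∎
    where
    open ≡-Reasoning
    u = sh (l ℕ.* e) f n
    lem₁ : ∀ x u y z → (x + u) - 1ℤ * (y + z) ≡ ((x - 1ℤ * y) + u) - 1ℤ * z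
    lem₁ = solve-∀
    lem₂ : ∀ x u z → ((x - 1ℤ * u) + u) - 1ℤ * z ≡ x - 1ℤ * z
    lem₂ = solve-∀

  S-nonNeg : ∀ e l f → (∀ n → 0ℤ ≤ f n) → ∀ n → 0ℤ ≤ S e l f n
  S-nonNeg e zero f f≥0 n = ≤-refl
  S-nonNeg e (suc l) f f≥0 n = +-mono-≤ (S-nonNeg e l f f≥0 n) (sh-nonNeg (l ℕ.* e) f n (λ i _ → f≥0 i))

  -- The single term q^(i e) already contributes `f n` and the others are nonnegative. Iterated,
  -- this turns a representation of n into a lower bound for the coefficient at n.
  S-lower : ∀ e l f → (∀ n → 0ℤ ≤ f n) → ∀ i n → i ℕ.< l → f n ≤ S e l f (i ℕ.* e ℕ.+ n)
  S-lower e (suc l) f f≥0 i n (s≤s i≤l) with ℕ.m≤n⇒m<n∨m≡n i≤l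
  ... | inj₁ i<l = ≤-trans (S-lower e l f f≥0 i n i<l)
    (subst (_≤ S e (suc l) f m) (+-identityʳ _) (+-monoʳ-≤ (S e l f m) (sh-nonNeg (l ℕ.* e) f m (λ i _ → f≥0 i))))
    where
    m = i ℕ.* e ℕ.+ n
  ... | inj₂ refl = subst₂ _≤_ (trans (+-identityˡ _) (sh-small (l ℕ.* e) f n)) refl
    (+-monoˡ-≤ (sh (l ℕ.* e) f (l ℕ.* e ℕ.+ n)) (S-nonNeg e l f f≥0 _))

-- Generating functions of weighted partitions.

module Partitions where

  open import Defs using (isKthPower; partsBounded; partitions; p; pMod)
  open Series
  open import Data.Bool using (Bool; true; false; if_then_else_; _∧_)
  open import Data.Bool.Properties using (T-≡)
  open import Data.Nat as ℕ using (ℕ; zero; suc; z≤n; s≤s; _^_; _⊓_; _∸_; _≡ᵇ_; _%_)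
  import Data.Nat.Properties as ℕ
  open import Data.Integer using (ℤ; +_; 0ℤ; 1ℤ; -1ℤ; _+_; _-_; -_; _*_)
  open import Data.Integer.Properties hiding (_≤?_)
  open import Data.Integer.Tactic.RingSolver using (solve-∀)
  open import Data.List using (List; []; _∷_; _++_; [_]; map; concatMap; upTo; filterᵇ; length)
  open import Data.Bool.ListAction using (all; any)
  open import Data.List.Properties using (upTo-∷ʳ)
  open import Data.List.Relation.Unary.Any using (satisfied)
  open import Data.List.Relation.Unary.Any.Properties using (any⁺; any⁻)
  open import Data.List.Membership.Propositional using (lose)
  open import Data.List.Membership.Propositional.Properties using (∈-map⁺; ∈-upTo⁺)
  open import Data.Product using (_,_; _×_)
  open import Data.Sum using (_⊎_; inj₁; inj₂)
  open import Data.Empty using (⊥-elim)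
  open import Relation.Nullary using (yes; no)
  open import Function.Bundles using (Equivalence)
  open import Relation.Binary.PropositionalEquality hiding ([_])

  weight : (ℕ → ℤ) → List ℕ → ℤ
  weight w [] = 1ℤ
  weight w (x ∷ xs) = w x * weight w xs

  Σℤ : {A : Set} → (A → ℤ) → List A → ℤ
  Σℤ g [] = 0ℤ
  Σℤ g (x ∷ xs) = g x + Σℤ g xs

  Σℤ-++ : {A : Set} (g : A → ℤ) (xs ys : List A) → Σℤ g (xs ++ ys) ≡ Σℤ g xs + Σℤ g ys
  Σℤ-++ g [] ys = sym (+-identityˡ _)
  Σℤ-++ g (x ∷ xs) ys = trans (cong (λ z → g x + z) (Σℤ-++ g xs ys)) (sym (+-assoc (g x) _ _))

  Σℤ-cong : {A : Set} {g h : A → ℤ} → g ≗ h → (xs : List A) → Σℤ g xs ≡ Σℤ h xs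
  Σℤ-cong e [] = refl
  Σℤ-cong e (x ∷ xs) = cong₂ _+_ (e x) (Σℤ-cong e xs)

  Σℤ-map : {A C : Set} (g : C → ℤ) (f : A → C) (xs : List A) → Σℤ g (map f xs) ≡ Σℤ (λ x → g (f x)) xs
  Σℤ-map g f [] = refl
  Σℤ-map g f (x ∷ xs) = cong (λ z → g (f x) + z) (Σℤ-map g f xs)

  Σℤ-concatMap : {A C : Set} (g : C → ℤ) (f : A → List C) (xs : List A) →
                 Σℤ g (concatMap f xs) ≡ Σℤ (λ x → Σℤ g (f x)) xs
  Σℤ-concatMap g f [] = refl
  Σℤ-concatMap g f (x ∷ xs) = trans (Σℤ-++ g (f x) (concatMap f xs)) (cong (λ z → Σℤ g (f x) + z) (Σℤ-concatMap g f xs))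

  Σℤ-* : {A : Set} (c : ℤ) (g : A → ℤ) (xs : List A) → Σℤ (λ x → c * g x) xs ≡ c * Σℤ g xs
  Σℤ-* c g [] = sym (*-zeroʳ c)
  Σℤ-* c g (x ∷ xs) = trans (cong (λ z → c * g x + z) (Σℤ-* c g xs)) (sym (*-distribˡ-+ c (g x) _))

  total : (ℕ → ℤ) → ℕ → ℕ → ℕ → ℤ
  total w f n mx = Σℤ (weight w) (partsBounded f n mx)

  total-suc : ∀ w f n mx → total w (suc f) (suc n) mx ≡
              Σℤ (λ j → w (suc j) * total w f (n ∸ j) (suc j)) (upTo (suc n ⊓ mx))
  total-suc w f n mx = trans (Σℤ-concatMap (weight w) _ (map suc (upTo (suc n ⊓ mx))))
    (trans (Σℤ-map _ suc (upTo (suc n ⊓ mx)))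
           (Σℤ-cong (λ j → trans (Σℤ-map (weight w) (suc j ∷_) (partsBounded f (n ∸ j) (suc j)))
                                  (Σℤ-* (w (suc j)) (weight w) (partsBounded f (n ∸ j) (suc j))))
                    (upTo (suc n ⊓ mx))))

  total-fuel : ∀ w f f′ n mx → n ℕ.≤ f → n ℕ.≤ f′ → total w f n mx ≡ total w f′ n mx
  total-fuel w f f′ zero mx _ _ = refl
  total-fuel w (suc f) (suc f′) (suc n) mx (s≤s n≤f) (s≤s n≤f′) =
    trans (total-suc w f n mx) (trans (Σℤ-cong (λ j → cong (w (suc j) *_)
      (total-fuel w f f′ (n ∸ j) (suc j) (ℕ.≤-trans (ℕ.m∸n≤m n j) n≤f) (ℕ.≤-trans (ℕ.m∸n≤m n j) n≤f′)))
      (upTo (suc n ⊓ mx))) (sym (total-suc w f′ n mx)))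

  -- The series of partitions into parts ≤ x, each part y weighted by w y: the product of 1/(1 - w(y) q^y) over y ≤ x.
  W : (ℕ → ℤ) → ℕ → Ser
  W w x n = total w n n x

  W-zero : ∀ w → W w 0 ≗ δ
  W-zero w zero = refl
  W-zero w (suc n) = refl

  -- Partitions are listed by their largest part, so those containing suc x form the last summand;
  -- removing one copy leaves a partition with the same bound. If suc x exceeds the total, this
  -- summand is absent and the shift vanishes.
  W-suc : ∀ w x n → W w (suc x) n ≡ W w x n + w (suc x) * sh (suc x) (W w (suc x)) n
  W-suc w x zero = sym (trans (cong (λ z → 1ℤ + z) (*-zeroʳ (w (suc x)))) (+-identityʳ 1ℤ))
  W-suc w x (suc n) with x ℕ.≤? n
  ... | yes x≤n = begin
    total w (suc n) (suc n) (suc x)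
      ≡⟨ total-suc w n n (suc x) ⟩
    Σℤ g (upTo (suc (n ⊓ x)))
      ≡⟨ cong (λ z → Σℤ g (upTo (suc z))) (ℕ.m≥n⇒m⊓n≡n x≤n) ⟩
    Σℤ g (upTo (suc x))
      ≡⟨ cong (Σℤ g) (upTo-∷ʳ x) ⟨
    Σℤ g (upTo x ++ [ x ])
      ≡⟨ Σℤ-++ g (upTo x) [ x ] ⟩
    Σℤ g (upTo x) + (g x + 0ℤ)
      ≡⟨ cong₂ _+_
           (sym (trans (total-suc w n n x) (cong (λ z → Σℤ g (upTo z)) (ℕ.m≥n⇒m⊓n≡n (ℕ.m≤n⇒m≤1+n x≤n)))))
           (trans (+-identityʳ (g x)) (cong (w (suc x) *_)
             (trans (total-fuel w n (n ∸ x) (n ∸ x) (suc x) (ℕ.m∸n≤m n x) ℕ.≤-refl)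
                    (sym (sh-∸ (suc x) (W w (suc x)) (suc n) (s≤s x≤n)))))) ⟩
    total w (suc n) (suc n) x + w (suc x) * sh (suc x) (W w (suc x)) (suc n) ∎
    where
    open ≡-Reasoning
    g : ℕ → ℤ
    g j = w (suc j) * total w n (n ∸ j) (suc j)
  ... | no x≰n = begin
    total w (suc n) (suc n) (suc x)
      ≡⟨ total-suc w n n (suc x) ⟩
    Σℤ g (upTo (suc (n ⊓ x)))
      ≡⟨ cong (λ z → Σℤ g (upTo z)) (trans (cong suc (ℕ.m≤n⇒m⊓n≡m (ℕ.<⇒≤ n<x))) (sym (ℕ.m≤n⇒m⊓n≡m n<x))) ⟩
    Σℤ g (upTo (suc n ⊓ x))
      ≡⟨ total-suc w n n x ⟨
    total w (suc n) (suc n) x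
      ≡⟨ trans (cong (λ z → total w (suc n) (suc n) x + z) (*-zeroʳ (w (suc x)))) (+-identityʳ _) ⟨
    total w (suc n) (suc n) x + w (suc x) * 0ℤ
      ≡⟨ cong (λ z → total w (suc n) (suc n) x + w (suc x) * z) (sh-big (suc x) (W w (suc x)) (suc n) (s≤s n<x)) ⟨
    total w (suc n) (suc n) x + w (suc x) * sh (suc x) (W w (suc x)) (suc n) ∎
    where
    open ≡-Reasoning
    n<x = ℕ.≰⇒> x≰n
    g : ℕ → ℤ
    g j = w (suc j) * total w n (n ∸ j) (suc j)

  W-B : ∀ w x → B (w (suc x)) (suc x) (W w (suc x)) ≗ W w x
  W-B w x n = trans (cong (_- w (suc x) * sh (suc x) (W w (suc x)) n) (W-suc w x n)) (lem _ _)
    where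
    lem : ∀ a b → (a + b) - b ≡ a
    lem = solve-∀

  W-skip : ∀ w x d → (∀ y → x ℕ.< y → y ℕ.≤ d ℕ.+ x → w y ≡ 0ℤ) → W w (d ℕ.+ x) ≗ W w x
  W-skip w x zero _ n = refl
  W-skip w x (suc d) h n = trans (W-suc w (d ℕ.+ x) n)
    (trans (cong₂ (λ a b → a + b * s) (W-skip w x d (λ y l u → h y l (ℕ.m≤n⇒m≤1+n u)) n)
      (h (suc (d ℕ.+ x)) (s≤s (ℕ.m≤n+m x d)) ℕ.≤-refl))
      (+-identityʳ _))
    where s = sh (suc d ℕ.+ x) (W w (suc d ℕ.+ x)) n

  W-full : ∀ w d n → W w (d ℕ.+ n) n ≡ W w n n
  W-full w zero n = refl
  W-full w (suc d) n = trans (W-suc w (d ℕ.+ n) n)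
    (trans (cong₂ (λ a b → a + w (suc (d ℕ.+ n)) * b) (W-full w d n)
      (sh-big (suc (d ℕ.+ n)) (W w (suc d ℕ.+ n)) n (s≤s (ℕ.m≤n+m n d))))
      (trans (cong (λ z → W w n n + z) (*-zeroʳ (w (suc (d ℕ.+ n))))) (+-identityʳ _)))

  W-cong : ∀ {w w′} → w ≗ w′ → ∀ x → W w x ≗ W w′ x
  W-cong {w} {w′} e x n = Σℤ-cong weight-cong (partsBounded n n x)
    where
    weight-cong : ∀ xs → weight w xs ≡ weight w′ xs
    weight-cong [] = refl
    weight-cong (y ∷ ys) = cong₂ _*_ (e y) (weight-cong ys)

  sgn : ℕ → ℤ
  sgn zero = 1ℤ
  sgn (suc n) = - sgn n

  sgn-sq : ∀ n → sgn n * sgn n ≡ 1ℤ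
  sgn-sq zero = refl
  sgn-sq (suc n) = trans (lem (sgn n)) (sgn-sq n)
    where
    lem : ∀ x → - x * - x ≡ x * x
    lem = solve-∀

  parity : ∀ n → (n % 2 ≡ 0 × sgn n ≡ 1ℤ) ⊎ (n % 2 ≡ 1 × sgn n ≡ -1ℤ)
  parity zero = inj₁ (refl , refl)
  parity (suc zero) = inj₂ (refl , refl)
  parity (suc (suc n)) with parity n
  ... | inj₁ (e , s) = inj₁ (e , trans (neg-involutive (sgn n)) s)
  ... | inj₂ (e , s) = inj₂ (e , trans (neg-involutive (sgn n)) s)

  sgn-sh : ∀ a f n → sgn n * sh a f n ≡ sgn a * sh a (λ i → sgn i * f i) n
  sgn-sh zero f n = sym (*-identityˡ _)
  sgn-sh (suc a) f zero = trans (*-zeroʳ 1ℤ) (sym (*-zeroʳ (- sgn a)))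
  sgn-sh (suc a) f (suc n) = trans (sym (neg-distribˡ-* (sgn n) (sh a f n)))
    (trans (cong -_ (sgn-sh a f n)) (neg-distribˡ-* (sgn a) _))

  -- The substitution q ↦ -q.
  W-twist : ∀ w x n → sgn n * W w x n ≡ W (λ y → sgn y * w y) x n
  W-twist w zero zero = refl
  W-twist w zero (suc n) = *-zeroʳ (sgn (suc n))
  -- Multiplied by 1 - (-1)^a w(a) q^a with a = suc x, both sides reduce to the identity for x.
  W-twist w (suc x) n = B-inj (sgn (suc x) * w (suc x)) (suc x) {λ i → sgn i * f i} {W (λ y → sgn y * w y) (suc x)} n (s≤s z≤n)
    (λ i _ → trans (lem i) (trans (W-twist w x i) (sym (W-B (λ y → sgn y * w y) x i)))) n ℕ.≤-refl
    where
    f = W w (suc x)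
    a = suc x
    alg₂ : ∀ s t c u v → s * u - (t * c) * v ≡ s * u - c * (t * v)
    alg₂ = solve-∀
    alg₃ : ∀ s c u v → s * u - c * (s * v) ≡ s * (u - c * v)
    alg₃ = solve-∀
    lem : ∀ i → B (sgn a * w a) a (λ j → sgn j * f j) i ≡ sgn i * W w x i
    lem i = trans (alg₂ (sgn i) (sgn a) (w a) (f i) (sh a (λ j → sgn j * f j) i))
      (trans (cong (λ z → sgn i * f i - w a * z) (sym (sgn-sh a f i)))
      (trans (alg₃ (sgn i) (w a) (f i) (sh a f i)) (cong (sgn i *_) (W-B w x i))))

  if-0 : Bool → ℤ → ℤ
  if-0 b z = if b then z else 0ℤ

  0^ : ∀ k → 1 ℕ.≤ k → 0 ^ k ≡ 0
  0^ (suc k) _ = refl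

  -- Partitions into k-th powers and the parity of the number of parts.

  module Powers (k : ℕ) (1≤k : 1 ℕ.≤ k) where

    instance
      k≢0 : ℕ.NonZero k
      k≢0 = ℕ.>-nonZero 1≤k

    m≤m^k : ∀ m → m ℕ.≤ m ^ k
    m≤m^k zero = z≤n
    m≤m^k (suc m) = subst (ℕ._≤ suc m ^ k) (ℕ.^-identityʳ (suc m)) (ℕ.^-monoʳ-≤ (suc m) 1≤k)

    isKthPower-^ : ∀ m → 1 ℕ.≤ m → isKthPower k (m ^ k) ≡ true
    isKthPower-^ (suc m) _ = Equivalence.to T-≡ (any⁺ (λ i → (i ^ k) ≡ᵇ (suc m ^ k))
      (lose (∈-map⁺ suc (∈-upTo⁺ (m≤m^k (suc m)))) (ℕ.≡⇒≡ᵇ (suc m ^ k) (suc m ^ k) refl)))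

    isKthPower-gap : ∀ m y → m ^ k ℕ.< y → y ℕ.< suc m ^ k → isKthPower k y ≡ false
    isKthPower-gap m y l u with isKthPower k y in eq
    ... | false = refl
    ... | true with satisfied (any⁻ (λ i → (i ^ k) ≡ᵇ y) (map suc (upTo y)) (Equivalence.from T-≡ eq))
    ...   | i , t with ℕ.≡ᵇ⇒≡ (i ^ k) y t
    ...     | refl with i ℕ.≤? m
    ...       | yes i≤m = ⊥-elim (ℕ.<⇒≱ l (ℕ.^-monoˡ-≤ k i≤m))
    ...       | no i≰m = ⊥-elim (ℕ.<⇒≱ u (ℕ.^-monoˡ-≤ k (ℕ.≰⇒> i≰m)))

    wt : (ℕ → ℤ) → ℕ → ℤ
    wt c y = if-0 (isKthPower k y) (c y)

    -- The product of 1/(1 - c(m^k) q^(m^k)) over 1 ≤ m ≤ x.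
    G : (ℕ → ℤ) → ℕ → Ser
    G c x = W (wt c) (x ^ k)

    G-zero : ∀ c → G c 0 ≗ δ
    G-zero c n = trans (cong (λ x → W (wt c) x n) (0^ k 1≤k)) (W-zero (wt c) n)

    private
      pred-pow : ∀ m → suc (ℕ.pred (suc m ^ k)) ≡ suc m ^ k
      pred-pow m = ℕ.suc-pred (suc m ^ k) {{ℕ.m^n≢0 (suc m) k}}

      pow-split : ∀ m → (ℕ.pred (suc m ^ k) ∸ m ^ k) ℕ.+ m ^ k ≡ ℕ.pred (suc m ^ k)
      pow-split m = ℕ.m∸n+n≡m (ℕ.≤-pred (subst (m ^ k ℕ.<_) (sym (pred-pow m)) (ℕ.^-monoˡ-< k ℕ.≤-refl)))

    -- Parts strictly between x^k and (x+1)^k have weight zero, so once the factor of (x+1)^k is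
    -- removed the bound drops to x^k at once.
    G-B : ∀ c x → B (c (suc x ^ k)) (suc x ^ k) (G c (suc x)) ≗ G c x
    G-B c x n = begin
      B (c (suc x ^ k)) (suc x ^ k) (W (wt c) (suc x ^ k)) n
        ≡⟨ cong (λ z → B z (suc x ^ k) (W (wt c) (suc x ^ k)) n) (cong (λ b → if-0 b (c (suc x ^ k))) (isKthPower-^ (suc x) (s≤s z≤n))) ⟨
      B (wt c (suc x ^ k)) (suc x ^ k) (W (wt c) (suc x ^ k)) n
        ≡⟨ cong (λ z → B (wt c z) z (W (wt c) z) n) (pred-pow x) ⟨
      B (wt c (suc y)) (suc y) (W (wt c) (suc y)) n
        ≡⟨ W-B (wt c) y n ⟩
      W (wt c) y n
        ≡⟨ cong (λ z → W (wt c) z n) (pow-split x) ⟨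
      W (wt c) ((y ∸ x ^ k) ℕ.+ x ^ k) n
        ≡⟨ W-skip (wt c) (x ^ k) (y ∸ x ^ k) (λ z l u → cong (λ b → if-0 b (c z)) (isKthPower-gap x z l
             (subst (z ℕ.<_) (pred-pow x) (s≤s (subst (z ℕ.≤_) (pow-split x) u))))) n ⟩
      W (wt c) (x ^ k) n ∎
      where
      open ≡-Reasoning
      y = ℕ.pred (suc x ^ k)

    private
      G-partitions : ∀ c x n → n ℕ.≤ x → Σℤ (weight (wt c)) (partitions n) ≡ G c x n
      G-partitions c x n n≤x = trans (sym (W-full (wt c) (x ^ k ∸ n) n))
        (cong (λ z → W (wt c) z n) (ℕ.m∸n+n≡m (ℕ.≤-trans n≤x (m≤m^k x))))

      length-filter : (P : List ℕ → Bool) (xss : List (List ℕ)) →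
                      + length (filterᵇ P xss) ≡ Σℤ (λ xs → if-0 (P xs) 1ℤ) xss
      length-filter P [] = refl
      length-filter P (xs ∷ xss) with P xs
      ... | true = cong (λ z → 1ℤ + z) (length-filter P xss)
      ... | false = trans (length-filter P xss) (sym (+-identityˡ _))

      weight-const : ∀ c xs → weight (wt (λ _ → c)) xs ≡ if-0 (all (isKthPower k) xs) (weight (λ _ → c) xs)
      weight-const c [] = refl
      weight-const c (x ∷ xs) with isKthPower k x
      ... | false = refl
      ... | true with all (isKthPower k) xs | weight-const c xs
      ...   | true | e = cong (c *_) e
      ...   | false | e = trans (cong (c *_) e) (*-zeroʳ c)

      weight-one : ∀ xs → weight (λ _ → 1ℤ) xs ≡ 1ℤ
      weight-one [] = refl
      weight-one (x ∷ xs) = trans (*-identityˡ _) (weight-one xs)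

      weight-neg : ∀ xs → weight (λ _ → -1ℤ) xs ≡ sgn (length xs)
      weight-neg [] = refl
      weight-neg (x ∷ xs) = trans (cong (-1ℤ *_) (weight-neg xs)) (-1*i≡-i (sgn (length xs)))

      hasParity : ℕ → List ℕ → Bool
      hasParity a xs = all (isKthPower k) xs ∧ ((length xs % 2) ≡ᵇ a)

      weight-plus : ∀ xs → weight (wt (λ _ → 1ℤ)) xs ≡ if-0 (hasParity 0 xs) 1ℤ + if-0 (hasParity 1 xs) 1ℤ
      weight-plus xs rewrite weight-const 1ℤ xs | weight-one xs with all (isKthPower k) xs | parity (length xs)
      ... | false | _ = refl
      ... | true | inj₁ (e , _) rewrite e = refl
      ... | true | inj₂ (e , _) rewrite e = refl

      weight-minus : ∀ xs → weight (wt (λ _ → -1ℤ)) xs ≡ if-0 (hasParity 0 xs) 1ℤ + -1ℤ * if-0 (hasParity 1 xs) 1ℤ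
      weight-minus xs rewrite weight-const -1ℤ xs | weight-neg xs with all (isKthPower k) xs | parity (length xs)
      ... | false | _ = refl
      ... | true | inj₁ (e , s) rewrite e | s = refl
      ... | true | inj₂ (e , s) rewrite e | s = refl

      Σℤ-add : {A : Set} (g h : A → ℤ) (xs : List A) → Σℤ (λ x → g x + h x) xs ≡ Σℤ g xs + Σℤ h xs
      Σℤ-add g h [] = refl
      Σℤ-add g h (x ∷ xs) = trans (cong (λ z → (g x + h x) + z) (Σℤ-add g h xs)) (lem (g x) (h x) _ _)
        where
        lem : ∀ a b c d → (a + b) + (c + d) ≡ (a + c) + (b + d)
        lem = solve-∀

    G-stable : ∀ c x y n → n ℕ.≤ x → n ℕ.≤ y → G c x n ≡ G c y n
    G-stable c x y n n≤x n≤y = trans (sym (G-partitions c x n n≤x)) (G-partitions c y n n≤y)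

    p-G : ∀ x n → n ℕ.≤ x → + p k n ≡ G (λ _ → 1ℤ) x n
    p-G x n n≤x = trans (length-filter (all (isKthPower k)) (partitions n))
      (trans (Σℤ-cong (λ xs → sym (trans (weight-const 1ℤ xs) (cong (if-0 _) (weight-one xs)))) (partitions n))
             (G-partitions (λ _ → 1ℤ) x n n≤x))

    p≡pMod+pMod : ∀ n → p k n ≡ pMod k 0 2 n ℕ.+ pMod k 1 2 n
    p≡pMod+pMod n = +-injective (trans (p-G n n ℕ.≤-refl) (trans (sym (G-partitions (λ _ → 1ℤ) n n ℕ.≤-refl))
      (trans (Σℤ-cong weight-plus (partitions n)) (trans (Σℤ-add (λ xs → if-0 (hasParity 0 xs) 1ℤ) _ (partitions n))
      (cong₂ _+_ (sym (length-filter (hasParity 0) (partitions n))) (sym (length-filter (hasParity 1) (partitions n))))))))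

    -- Weight -1 per part produces (-1)^(number of parts). The substitution q ↦ -q changes the
    -- weight of y into -(-1)^y, at the price of the factor (-1)^n.
    pMod-pMod : ∀ x n → n ℕ.≤ x → + pMod k 0 2 n - + pMod k 1 2 n ≡ sgn n * G (λ y → - sgn y) x n
    pMod-pMod x n n≤x = begin
      + pMod k 0 2 n - + pMod k 1 2 n
        ≡⟨ cong₂ _-_ (length-filter (hasParity 0) (partitions n)) (length-filter (hasParity 1) (partitions n)) ⟩
      Σℤ (λ xs → if-0 (hasParity 0 xs) 1ℤ) (partitions n) - Σℤ (λ xs → if-0 (hasParity 1 xs) 1ℤ) (partitions n)
        ≡⟨ cong (λ z → Σℤ (λ xs → if-0 (hasParity 0 xs) 1ℤ) (partitions n) + z)
             (trans (sym (-1*i≡-i _)) (sym (Σℤ-* -1ℤ _ (partitions n)))) ⟩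
      Σℤ (λ xs → if-0 (hasParity 0 xs) 1ℤ) (partitions n) + Σℤ (λ xs → -1ℤ * if-0 (hasParity 1 xs) 1ℤ) (partitions n)
        ≡⟨ Σℤ-add _ _ (partitions n) ⟨
      Σℤ (λ xs → if-0 (hasParity 0 xs) 1ℤ + -1ℤ * if-0 (hasParity 1 xs) 1ℤ) (partitions n)
        ≡⟨ Σℤ-cong weight-minus (partitions n) ⟨
      Σℤ (weight (wt (λ _ → -1ℤ))) (partitions n)
        ≡⟨ G-partitions (λ _ → -1ℤ) x n n≤x ⟩
      G (λ _ → -1ℤ) x n
        ≡⟨ *-identityˡ _ ⟨
      -- The factor 1 becomes a square of signs; `W-twist` absorbs one of the two.
      1ℤ * G (λ _ → -1ℤ) x n
        ≡⟨ cong (_* G (λ _ → -1ℤ) x n) (sgn-sq n) ⟨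
      (sgn n * sgn n) * G (λ _ → -1ℤ) x n
        ≡⟨ *-assoc (sgn n) (sgn n) _ ⟩
      sgn n * (sgn n * G (λ _ → -1ℤ) x n)
        ≡⟨ cong (sgn n *_) (trans (W-twist (wt (λ _ → -1ℤ)) (x ^ k) n) (W-cong twist-wt (x ^ k) n)) ⟩
      sgn n * G (λ y → - sgn y) x n ∎
      where
      open ≡-Reasoning
      twist-wt : ∀ y → sgn y * wt (λ _ → -1ℤ) y ≡ wt (λ z → - sgn z) y
      twist-wt y with isKthPower k y
      ... | true = trans (*-comm (sgn y) -1ℤ) (-1*i≡-i (sgn y))
      ... | false = *-zeroʳ (sgn y)

-- Product formula for the signed count: nonnegativity and an upper bound.

module SignedCount where

  open import Defs using (pMod)
  open Series
  open Partitions
  open import Data.Bool using (Bool; true; false; if_then_else_; _∧_; not; _xor_)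
  open import Data.Bool.Properties using (not-involutive; ∧-idem)
  open import Data.Nat as ℕ using (ℕ; zero; suc; z≤n; s≤s; _^_; _∸_)
  import Data.Nat.Properties as ℕ
  open import Data.Integer using (ℤ; +_; 0ℤ; 1ℤ; -1ℤ; _+_; _-_; -_; _*_; _≤_; +≤+)
  open import Data.Integer.Properties hiding (_≤?_)
  open import Data.Integer.Tactic.RingSolver using (solve-∀)
  open import Relation.Binary.PropositionalEquality

  isOdd : ℕ → Bool
  isOdd zero = false
  isOdd (suc n) = not (isOdd n)

  isOdd-+ : ∀ m n → isOdd (m ℕ.+ n) ≡ isOdd m xor isOdd n
  isOdd-+ zero n = refl
  isOdd-+ (suc m) n rewrite isOdd-+ m n with isOdd m
  ... | true = not-involutive (isOdd n)
  ... | false = refl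

  isOdd-* : ∀ m n → isOdd (m ℕ.* n) ≡ isOdd m ∧ isOdd n
  isOdd-* zero n = refl
  isOdd-* (suc m) n rewrite isOdd-+ n (m ℕ.* n) | isOdd-* m n with isOdd m | isOdd n
  ... | true  | true  = refl
  ... | true  | false = refl
  ... | false | true  = refl
  ... | false | false = refl

  isOdd-^ : ∀ m k → 1 ℕ.≤ k → isOdd (m ^ k) ≡ isOdd m
  isOdd-^ m (suc zero) _ = cong isOdd (ℕ.^-identityʳ m)
  isOdd-^ m (suc (suc k)) _ = trans (isOdd-* m (m ^ suc k))
    (trans (cong (isOdd m ∧_) (isOdd-^ m (suc k) (s≤s z≤n))) (∧-idem (isOdd m)))

  sgn-isOdd : ∀ n → - sgn n ≡ (if isOdd n then 1ℤ else -1ℤ)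
  sgn-isOdd zero = refl
  sgn-isOdd (suc n) = trans (cong -_ (sgn-isOdd n)) (flip (isOdd n))
    where
    flip : ∀ b → - (if b then 1ℤ else -1ℤ) ≡ (if not b then 1ℤ else -1ℤ)
    flip true = refl
    flip false = refl

  ^-distribʳ-* : ∀ k m n → (m ℕ.* n) ^ k ≡ m ^ k ℕ.* n ^ k
  ^-distribʳ-* zero m n = refl
  ^-distribʳ-* (suc k) m n = trans (cong (m ℕ.* n ℕ.*_) (^-distribʳ-* k m n))
    (ℕ.[m*n]*[o*p]≡[m*o]*[n*p] m n (m ^ k) (n ^ k))

  double : ℕ → ℕ
  double zero = zero
  double (suc n) = suc (suc (double n))

  isOdd-double : ∀ n → isOdd (double n) ≡ false
  isOdd-double zero = refl
  isOdd-double (suc n) = trans (not-involutive _) (isOdd-double n)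

  double≡2* : ∀ n → double n ≡ 2 ℕ.* n
  double≡2* zero = refl
  double≡2* (suc n) = cong suc (trans (cong suc (double≡2* n)) (sym (ℕ.+-suc n (n ℕ.+ 0))))

  n≤double : ∀ n → n ℕ.≤ double n
  n≤double n = subst (n ℕ.≤_) (sym (double≡2* n)) (ℕ.m≤m+n n _)

  B-square : ∀ a f → B 1ℤ (2 ℕ.* a) f ≗ B 1ℤ a (B -1ℤ a f)
  B-square a f n = begin
    f n - 1ℤ * sh (a ℕ.+ (a ℕ.+ 0)) f n
      ≡⟨ cong (λ b → f n - 1ℤ * sh (a ℕ.+ b) f n) (ℕ.+-identityʳ a) ⟩
    f n - 1ℤ * sh (a ℕ.+ a) f n
      ≡⟨ cong (λ z → f n - 1ℤ * z) (sh-+ a a f n) ⟨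
    f n - 1ℤ * sh a (sh a f) n
      ≡⟨ lem (f n) (sh a f n) (sh a (sh a f) n) ⟩
    (f n - -1ℤ * sh a f n) - 1ℤ * (sh a f n - -1ℤ * sh a (sh a f) n)
      ≡⟨ cong (λ z → (f n - -1ℤ * sh a f n) - 1ℤ * z) (sh-B a -1ℤ a f n) ⟨
    B 1ℤ a (B -1ℤ a f) n ∎
    where
    open ≡-Reasoning
    lem : ∀ x y z → x - 1ℤ * z ≡ (x - -1ℤ * y) - 1ℤ * (y - -1ℤ * z)
    lem = solve-∀

  δ≥0 : ∀ n → 0ℤ ≤ δ n
  δ≥0 zero = +≤+ z≤n
  δ≥0 (suc n) = +≤+ z≤n

  module Signed (k : ℕ) (1≤k : 1 ℕ.≤ k) where

    open Powers k 1≤k public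

    -- For n ≤ x the coefficient at n is (-1)^n times the even count minus the odd count, by
    -- `pMod-pMod`.
    D : ℕ → Ser
    D = G (λ y → - sgn y)

    D-B : ∀ x → B (if isOdd (suc x) then 1ℤ else -1ℤ) (suc x ^ k) (D (suc x)) ≗ D x
    D-B x n = trans (cong (λ c → B c (suc x ^ k) (D (suc x)) n)
      (sym (trans (sgn-isOdd (suc x ^ k)) (cong (λ b → if b then 1ℤ else -1ℤ) (isOdd-^ (suc x) k 1≤k)))))
      (G-B _ x n)

    -- 1/(1 - q^(m^k)) and 1/(1 + q^(m^k)) for odd and even m are both
    -- (1 - q^(m^k) [m even]) / (1 - q^(e m)), and the numerator for 2m cancels
    -- the denominator for m, leaving 1 + q^(e m) + … + q^(e m (L m - 1)).
    e L : ℕ → ℕ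
    e m = if isOdd m then m ^ k else 2 ℕ.* m ^ k
    L m = if isOdd m then 2 ^ k else 2 ^ (k ∸ 1)

    L*e : ∀ m → L m ℕ.* e m ≡ double m ^ k
    L*e m with isOdd m
    ... | true = trans (sym (^-distribʳ-* k 2 m)) (cong (_^ k) (sym (double≡2* m)))
    ... | false = begin
      2 ^ (k ∸ 1) ℕ.* (2 ℕ.* m ^ k) ≡⟨ ℕ.*-assoc (2 ^ (k ∸ 1)) 2 (m ^ k) ⟨
      2 ^ (k ∸ 1) ℕ.* 2 ℕ.* m ^ k   ≡⟨ cong (ℕ._* m ^ k) (ℕ.*-comm (2 ^ (k ∸ 1)) 2) ⟩
      2 ^ suc (k ∸ 1) ℕ.* m ^ k     ≡⟨ cong (λ l → 2 ^ l ℕ.* m ^ k) (ℕ.m+[n∸m]≡n 1≤k) ⟩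
      2 ^ k ℕ.* m ^ k               ≡⟨ ^-distribʳ-* k 2 m ⟨
      (2 ℕ.* m) ^ k                 ≡⟨ cong (_^ k) (double≡2* m) ⟨
      double m ^ k                  ∎
      where open ≡-Reasoning

    m≤e : ∀ m → m ℕ.≤ e m
    m≤e m with isOdd m
    ... | true = m≤m^k m
    ... | false = ℕ.≤-trans (m≤m^k m) (ℕ.m≤m+n (m ^ k) _)

    -- The common denominator, the product of the 1 - q^(e j) for j ≤ m. Multiplied by such
    -- denominators, both `h x` and `D (double x)` become `U x`, which is how they are compared.
    N : ℕ → Ser → Ser
    N zero f = f
    N (suc m) f = B 1ℤ (e (suc m)) (N m f)

    U : ℕ → Ser
    U zero = δ
    U (suc x) = B 1ℤ (double (suc x) ^ k) (U x)

    h : ℕ → Ser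
    h zero = δ
    h (suc m) = S (e (suc m)) (L (suc m)) (h m)

    h-nonNeg : ∀ m n → 0ℤ ≤ h m n
    h-nonNeg zero = δ≥0
    h-nonNeg (suc m) = S-nonNeg (e (suc m)) (L (suc m)) (h m) (h-nonNeg m)

    private
      N-cong : ∀ m {f g} → f ≗ g → N m f ≗ N m g
      N-cong zero eq = eq
      N-cong (suc m) eq = B-cong′ 1ℤ (e (suc m)) (N-cong m eq)

      N-B : ∀ m c a f → N m (B c a f) ≗ B c a (N m f)
      N-B zero c a f n = refl
      N-B (suc m) c a f n = trans (B-cong′ 1ℤ (e (suc m)) (N-B m c a f) n) (B-comm 1ℤ (e (suc m)) c a (N m f) n)

      N-h : ∀ x → N x (h x) ≗ U x
      N-h zero n = refl
      N-h (suc x) n = begin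
        B 1ℤ (e m) (N x (S (e m) (L m) (h x))) n  ≡⟨ N-B x 1ℤ (e m) (S (e m) (L m) (h x)) n ⟨
        N x (B 1ℤ (e m) (S (e m) (L m) (h x))) n  ≡⟨ N-cong x (S-telescope (e m) (L m) (h x)) n ⟩
        N x (B 1ℤ (L m ℕ.* e m) (h x)) n          ≡⟨ N-B x 1ℤ (L m ℕ.* e m) (h x) n ⟩
        B 1ℤ (L m ℕ.* e m) (N x (h x)) n          ≡⟨ B-cong′ 1ℤ (L m ℕ.* e m) (N-h x) n ⟩
        B 1ℤ (L m ℕ.* e m) (U x) n                ≡⟨ cong (λ a → B 1ℤ a (U x) n) (L*e m) ⟩
        B 1ℤ (double m ^ k) (U x) n               ∎
        where
        open ≡-Reasoning
        m = suc x

      -- One step treats the pair m₁ = 2x + 1, m₂ = 2x + 2. The factor 1 - q^(m₁^k) cancels against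
      -- `D`. The factor 1 - q^(2 m₂^k) splits into 1 + q^(m₂^k), which cancels too, and 1 -
      -- q^(m₂^k), which is the new factor of `U`.
      N-D : ∀ x → N (double x) (D (double x)) ≗ U x
      N-D zero n = G-zero _ n
      N-D (suc x) n = begin
        B 1ℤ (e m₂) (B 1ℤ (e m₁) F) n
          ≡⟨ cong₂ (λ a b → B 1ℤ a (B 1ℤ b F) n)
               (cong (λ b → if b then m₂ ^ k else 2 ℕ.* m₂ ^ k) (isOdd-double (suc x)))
               (cong (λ b → if not b then m₁ ^ k else 2 ℕ.* m₁ ^ k) (isOdd-double x)) ⟩
        B 1ℤ (2 ℕ.* m₂ ^ k) (B 1ℤ (m₁ ^ k) F) n
          ≡⟨ B-square (m₂ ^ k) (B 1ℤ (m₁ ^ k) F) n ⟩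
        B 1ℤ (m₂ ^ k) (B -1ℤ (m₂ ^ k) (B 1ℤ (m₁ ^ k) F)) n
          ≡⟨ B-cong′ 1ℤ (m₂ ^ k) inner n ⟩
        B 1ℤ (m₂ ^ k) (U x) n ∎
        where
        open ≡-Reasoning
        m₁ = suc (double x)
        m₂ = suc m₁
        F = N (double x) (D m₂)
        D-m₂ : B -1ℤ (m₂ ^ k) (D m₂) ≗ D m₁
        D-m₂ i = trans (cong (λ b → B (if b then 1ℤ else -1ℤ) (m₂ ^ k) (D m₂) i) (sym (isOdd-double (suc x)))) (D-B m₁ i)
        D-m₁ : B 1ℤ (m₁ ^ k) (D m₁) ≗ D (double x)
        D-m₁ i = trans (cong (λ b → B (if not b then 1ℤ else -1ℤ) (m₁ ^ k) (D m₁) i) (sym (isOdd-double x))) (D-B (double x) i)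
        inner : B -1ℤ (m₂ ^ k) (B 1ℤ (m₁ ^ k) F) ≗ U x
        inner i = begin
          B -1ℤ (m₂ ^ k) (B 1ℤ (m₁ ^ k) F) i
            ≡⟨ B-comm -1ℤ (m₂ ^ k) 1ℤ (m₁ ^ k) F i ⟩
          B 1ℤ (m₁ ^ k) (B -1ℤ (m₂ ^ k) F) i
            ≡⟨ B-cong′ 1ℤ (m₁ ^ k) (λ j → trans (sym (N-B (double x) -1ℤ (m₂ ^ k) (D m₂) j)) (N-cong (double x) D-m₂ j)) i ⟩
          B 1ℤ (m₁ ^ k) (N (double x) (D m₁)) i
            ≡⟨ trans (sym (N-B (double x) 1ℤ (m₁ ^ k) (D m₁) i)) (N-cong (double x) D-m₁ i) ⟩
          N (double x) (D (double x)) i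
            ≡⟨ N-D x i ⟩
          U x i ∎

      -- As e m ≥ m > i for every m > x, the later factors do not reach degree i. This reconciles
      -- the 2x factors in `N-D` with the x factors in `N-h`.
      N-trunc : ∀ d x f i → i ℕ.≤ x → N (d ℕ.+ x) f i ≡ N x f i
      N-trunc zero x f i i≤x = refl
      N-trunc (suc d) x f i i≤x = trans
        (cong (λ z → N (d ℕ.+ x) f i - 1ℤ * z) (sh-big (e (suc d ℕ.+ x)) (N (d ℕ.+ x) f) i
          (ℕ.≤-trans (s≤s (ℕ.≤-trans i≤x (ℕ.m≤n+m x d))) (m≤e (suc d ℕ.+ x)))))
        (trans (+-identityʳ _) (N-trunc d x f i i≤x))

      N-inj : ∀ m {f g} X → (∀ i → i ℕ.≤ X → N m f i ≡ N m g i) → ∀ i → i ℕ.≤ X → f i ≡ g i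
      N-inj zero X eq = eq
      N-inj (suc m) X eq = N-inj m X (B-inj 1ℤ (e (suc m)) X (ℕ.≤-trans (s≤s z≤n) (m≤e (suc m))) eq)

    D≡h : ∀ x i → i ℕ.≤ x → D (double x) i ≡ h x i
    D≡h x = N-inj x x λ i i≤x → trans
      (trans (sym (N-trunc (double x ∸ x) x (D (double x)) i i≤x))
        (cong (λ m → N m (D (double x)) i) (ℕ.m∸n+n≡m (n≤double x))))
      (trans (N-D x i) (sym (N-h x i)))

    pMod-pMod-h : ∀ x n → n ℕ.≤ x → + pMod k 0 2 n - + pMod k 1 2 n ≡ sgn n * h x n
    pMod-pMod-h x n n≤x = trans (pMod-pMod (double x) n (ℕ.≤-trans n≤x (n≤double x))) (cong (sgn n *_) (D≡h x n n≤x))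

    odd-only : ℕ → ℤ
    odd-only y = if isOdd y then 1ℤ else 0ℤ

    O : ℕ → Ser
    O = G odd-only

    O-B : ∀ x → B (odd-only (suc x)) (suc x ^ k) (O (suc x)) ≗ O x
    O-B x n = trans (cong (λ b → B (if b then 1ℤ else 0ℤ) (suc x ^ k) (O (suc x)) n) (sym (isOdd-^ (suc x) k 1≤k))) (G-B odd-only x n)

    private
      -- Multiplication by 1 + q^(j^k) for the even j ≤ m. It clears the even denominators of `D`
      -- and so carries `D x` to `O x`.
      E : ℕ → Ser → Ser
      E zero f = f
      E (suc m) f = if isOdd (suc m) then E m f else B -1ℤ (suc m ^ k) (E m f)

      E-cong : ∀ m {f g} → f ≗ g → E m f ≗ E m g
      E-cong zero eq = eq
      E-cong (suc m) eq with isOdd (suc m)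
      ... | true = E-cong m eq
      ... | false = B-cong′ -1ℤ (suc m ^ k) (E-cong m eq)

      E-B : ∀ m c a f → E m (B c a f) ≗ B c a (E m f)
      E-B zero c a f n = refl
      E-B (suc m) c a f n with isOdd (suc m)
      ... | true = E-B m c a f n
      ... | false = trans (B-cong′ -1ℤ (suc m ^ k) (E-B m c a f) n) (B-comm -1ℤ (suc m ^ k) c a (E m f) n)

      B-0 : ∀ a f → B 0ℤ a f ≗ f
      B-0 a f n = +-identityʳ (f n)

      E-D : ∀ x → E x (D x) ≗ O x
      E-D zero n = trans (G-zero _ n) (sym (G-zero _ n))
      E-D (suc x) n with isOdd (suc x) | D-B x | O-B x
      ... | true | D-odd | O-odd = B-inj 1ℤ (suc x ^ k) {E x (D (suc x))} {O (suc x)} n (ℕ.≤-trans (s≤s z≤n) (m≤m^k (suc x)))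
        (λ i _ → trans (sym (E-B x 1ℤ (suc x ^ k) (D (suc x)) i))
          (trans (E-cong x D-odd i) (trans (E-D x i) (sym (O-odd i))))) n ℕ.≤-refl
      ... | false | D-even | O-even = trans (sym (E-B x -1ℤ (suc x ^ k) (D (suc x)) n))
        (trans (E-cong x D-even n) (trans (E-D x n) (trans (sym (O-even n)) (B-0 (suc x ^ k) (O (suc x)) n))))

      -- Adding a shifted copy cannot lower nonnegative coefficients. Nonnegativity is assumed only
      -- up to `n` because `D x` is identified with the nonnegative `h` only in degrees up to x.
      E-lower : ∀ m f n → (∀ i → i ℕ.≤ n → 0ℤ ≤ f i) → ∀ i → i ℕ.≤ n → f i ≤ E m f i
      E-lower zero f n f≥0 i i≤n = ≤-refl
      E-lower (suc m) f n f≥0 i i≤n with isOdd (suc m)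
      ... | true = E-lower m f n f≥0 i i≤n
      ... | false = ≤-trans (E-lower m f n f≥0 i i≤n) (subst₂ _≤_ (+-identityʳ _)
        (cong (λ z → E m f i + z) (sym (neg-1* (sh (suc m ^ k) (E m f) i))))
        (+-monoʳ-≤ (E m f i) (sh-nonNeg (suc m ^ k) (E m f) i λ j j≤i →
          let j≤n = ℕ.≤-trans j≤i i≤n in ≤-trans (f≥0 j j≤n) (E-lower m f n f≥0 j j≤n))))
        where
        neg-1* : ∀ z → - (-1ℤ * z) ≡ z
        neg-1* = solve-∀

    D≡h′ : ∀ x n → n ℕ.≤ x → D x n ≡ h n n
    D≡h′ x n n≤x = trans (G-stable _ x (double n) n n≤x (n≤double n)) (D≡h n n ℕ.≤-refl)

    h≤O : ∀ x n → n ℕ.≤ x → h n n ≤ O x n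
    h≤O x n n≤x = subst₂ _≤_ (D≡h′ x n n≤x) (E-D x n)
      (E-lower x (D x) n (λ i i≤n → subst (0ℤ ≤_) (sym (D≡h′ x i (ℕ.≤-trans i≤n n≤x))) (h-nonNeg i i)) n ℕ.≤-refl)

-- Large integers as sums of k-th powers with bounded multiplicities.

module Representation where

  open import Data.Nat
  open import Data.Nat.Properties
  open import Data.Nat.DivMod
  open import Data.Nat.Tactic.RingSolver using (solve-∀)
  open import Data.Product using (_,_; _×_; proj₁; proj₂; ∃-syntax)
  open import Relation.Nullary using (yes; no)
  open import Relation.Binary.PropositionalEquality
  open SignedCount using (^-distribʳ-*)

  -- n = Σ i(l) a(l) over lo ≤ l < hi with 0 ≤ i(l) ≤ b.
  data Rep (a : ℕ → ℕ) (b lo : ℕ) : ℕ → ℕ → Set where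
    nil  : Rep a b lo lo 0
    snoc : ∀ {hi n} i → i ≤ b → Rep a b lo hi n → Rep a b lo (suc hi) (i * a hi + n)

  module _ {a : ℕ → ℕ} {b : ℕ} where

    Rep-++ : ∀ {lo mid hi m n} → Rep a b lo mid m → Rep a b mid hi n → Rep a b lo hi (n + m)
    Rep-++ r nil = r
    Rep-++ {m = m} r (snoc {n = n} i i≤b s) =
      subst (Rep a b _ _) (sym (+-assoc (i * a _) n m)) (snoc i i≤b (Rep-++ r s))

    Rep-pad : ∀ {lo hi n} d → Rep a b lo hi n → Rep a b lo (d + hi) n
    Rep-pad zero r = r
    Rep-pad (suc d) r = snoc 0 z≤n (Rep-pad d r)

    Rep-pad-≤ : ∀ {lo hi hi′ n} → hi ≤ hi′ → Rep a b lo hi n → Rep a b lo hi′ n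
    Rep-pad-≤ {lo} {hi} {hi′} {n} hi≤hi′ r = subst (λ z → Rep a b lo z n) (m∸n+n≡m hi≤hi′) (Rep-pad (hi′ ∸ hi) r)

    Rep-extendˡ : ∀ {lo lo′ hi n} → lo ≤ lo′ → Rep a b lo′ hi n → Rep a b lo hi n
    Rep-extendˡ {n = n} lo≤lo′ r = subst (Rep a b _ _) (+-identityʳ n) (Rep-++ (Rep-pad-≤ lo≤lo′ nil) r)

    largest : ℕ → ℕ
    largest zero = 0
    largest (suc hi) = b * a hi + largest hi

    Rep-bound : ∀ {lo hi n} → Rep a b lo hi n → n ≤ largest hi
    Rep-bound nil = z≤n
    Rep-bound (snoc {hi} i i≤b r) = +-mono-≤ (*-monoˡ-≤ (a hi) i≤b) (Rep-bound r)

  -- IsDeg n f: f is a polynomial of degree n with positive leading coefficient, through its finite differences.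
  IsDeg : ℕ → (ℕ → ℕ) → Set
  IsDeg zero f = ∃[ c ] (1 ≤ c × (∀ x → f x ≡ c))
  IsDeg (suc n) f = ∀ d → 1 ≤ d → ∃[ g ] ((∀ x → f (x + d) ≡ f x + g x) × IsDeg n g)

  IsDeg-shift : ∀ n f e → IsDeg n f → IsDeg n (λ x → f (x + e))
  IsDeg-shift zero f e (c , 1≤c , eq) = c , 1≤c , λ x → eq (x + e)
  IsDeg-shift (suc n) f e F d 1≤d with F d 1≤d
  ... | g , eq , G = (λ x → g (x + e)) ,
    (λ x → trans (cong f (lem x d e)) (eq (x + e))) , IsDeg-shift n g e G
    where
    lem : ∀ x d e → x + d + e ≡ x + e + d
    lem = solve-∀

  IsDeg-+ : ∀ n f g → IsDeg n f → IsDeg n g → IsDeg n (λ x → f x + g x)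
  IsDeg-+ zero f g (c , 1≤c , p) (d , 1≤d , q) = c + d , ≤-trans 1≤c (m≤m+n c d) , λ x → cong₂ _+_ (p x) (q x)
  IsDeg-+ (suc n) f g F G d 1≤d with F d 1≤d | G d 1≤d
  ... | f′ , p , F′ | g′ , q , G′ = (λ x → f′ x + g′ x) ,
    (λ x → trans (cong₂ _+_ (p x) (q x)) (lem (f x) (f′ x) (g x) (g′ x))) , IsDeg-+ n f′ g′ F′ G′
    where
    lem : ∀ a b c d → a + b + (c + d) ≡ a + c + (b + d)
    lem = solve-∀

  IsDeg-scale : ∀ n c f → 1 ≤ c → IsDeg n f → IsDeg n (λ x → c * f x)
  IsDeg-scale zero c f 1≤c (d , 1≤d , p) = c * d , *-mono-≤ 1≤c 1≤d , λ x → cong (c *_) (p x)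
  IsDeg-scale (suc n) c f 1≤c F d 1≤d with F d 1≤d
  ... | f′ , p , F′ = (λ x → c * f′ x) , (λ x → trans (cong (c *_) (p x)) (*-distribˡ-+ c (f x) (f′ x))) , IsDeg-scale n c f′ 1≤c F′

  -- Discrete product rule: with step d, the difference of x f(x) is x times the difference of f,
  -- plus d f(x + d).
  IsDeg-x* : ∀ n f → IsDeg n f → IsDeg (suc n) (λ x → x * f x)
  IsDeg-x* zero f (c , 1≤c , p) d 1≤d = (λ _ → d * c) ,
    (λ x → trans (cong ((x + d) *_) (p (x + d))) (trans (*-distribʳ-+ c x d) (cong (λ z → x * z + d * c) (sym (p x))))) ,
    (d * c , *-mono-≤ 1≤d 1≤c , λ _ → refl)
  IsDeg-x* (suc n) f F d 1≤d with F d 1≤d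
  ... | f′ , p , F′ = (λ x → x * f′ x + d * f (x + d)) ,
    (λ x → trans (*-distribʳ-+ (f (x + d)) x d) (trans (cong (λ z → x * z + d * f (x + d)) (p x)) (lem x (f x) (f′ x) (d * f (x + d))))) ,
    IsDeg-+ (suc n) _ _ (IsDeg-x* n f′ F′) (IsDeg-scale (suc n) d _ 1≤d (IsDeg-shift (suc n) f d F))
    where
    lem : ∀ x a b c → x * (a + b) + c ≡ x * a + (x * b + c)
    lem = solve-∀

  IsDeg-^ : ∀ n → IsDeg n (_^ n)
  IsDeg-^ zero = 1 , ≤-refl , λ _ → refl
  IsDeg-^ (suc n) = IsDeg-x* n (_^ n) (IsDeg-^ n)

  ^-residue : ∀ M z n → ∃[ q ] ((M * z + 1) ^ n ≡ 1 + M * q)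
  ^-residue M z zero = 0 , cong suc (sym (*-zeroʳ M))
  ^-residue M z (suc n) with ^-residue M z n
  ... | q , eq = z + q + z * (M * q) , trans (cong ((M * z + 1) *_) eq) (lem M z q)
    where
    lem : ∀ M z q → (M * z + 1) * (1 + M * q) ≡ 1 + M * (z + q + z * (M * q))
    lem = solve-∀

  -- The Thue–Morse signs turn Σ ± (x + i)^k over 0 ≤ i < 2^k into an iterated k-th difference, hence a constant:
  -- α and β are the sums over the positive and the negative signs.
  module ThueMorse (k : ℕ) where

    α β : ℕ → ℕ → ℕ
    α zero x = x ^ k
    α (suc i) x = α i (x + 2 ^ i) + β i x
    β zero x = 0
    β (suc i) x = β i (x + 2 ^ i) + α i x

    -- `α i` minus `β i` is the difference of x^k iterated with steps 1, 2, ..., 2^(i-1), each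
    -- lowering the degree by one. The additive form avoids subtraction.
    α-β : ∀ i j → i + j ≡ k → ∃[ g ] ((∀ x → α i x ≡ β i x + g x) × IsDeg j g)
    α-β zero j refl = (_^ k) , (λ _ → refl) , IsDeg-^ k
    α-β (suc i) j eq with α-β i (suc j) (trans (+-suc i j) eq)
    ... | g , α≡β+g , G with G (2 ^ i) (m^n>0 2 i)
    ...   | g′ , p , G′ = g′ , (λ x → trans
      (cong (_+ β i x) (trans (α≡β+g (x + 2 ^ i)) (cong (β i (x + 2 ^ i) +_) (p x))))
      (trans (lem (β i (x + 2 ^ i)) (g x) (g′ x) (β i x))
        (cong (λ z → β i (x + 2 ^ i) + z + g′ x) (sym (α≡β+g x))))) , G′
      where
      lem : ∀ b g g′ c → b + (g + g′) + c ≡ b + (c + g) + g′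
      lem = solve-∀

    α-β-const : ∃[ C ] (1 ≤ C × (∀ x → α k x ≡ β k x + C))
    α-β-const with α-β k 0 (+-identityʳ k)
    ... | g , p , (C , 1≤C , q) = C , 1≤C , λ x → trans (p x) (cong (β k x +_) (q x))

    -- Among the indices s (x + j) with j < 2^i, those of positive sign get multiplicity d and those
    -- of negative sign d′; indices between them get 0. The lower half of a block has the opposite
    -- signs, hence the swap of d and d′ in the recursion.
    block : ∀ T s i x d d′ → 1 ≤ s → d ≤ T → d′ ≤ T →
            Rep (_^ k) T (s * x) (s * (x + 2 ^ i)) (s ^ k * (α i x * d + β i x * d′))
    block T (suc s) zero x d d′ _ d≤T _ = subst₂ (Rep (_^ k) T (suc s * x)) (lem₁ s x)
      (trans (cong (λ z → d * z + 0) (^-distribʳ-* k (suc s) x)) (lem₂ d (suc s ^ k) (x ^ k) d′))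
      (Rep-pad s (snoc d d≤T nil))
      where
      lem₁ : ∀ s x → s + suc (suc s * x) ≡ suc s * (x + 1)
      lem₁ = solve-∀
      lem₂ : ∀ d s x d′ → d * (s * x) + 0 ≡ s * (x * d + 0 * d′)
      lem₂ = solve-∀
    block T s (suc i) x d d′ 1≤s d≤T d′≤T = subst₂ (Rep (_^ k) T (s * x)) (cong (s *_) (lem₁ x (2 ^ i)))
      (lem₂ (s ^ k) (α i (x + 2 ^ i)) (β i (x + 2 ^ i)) (α i x) (β i x) d d′)
      (Rep-++ (block T s i x d′ d 1≤s d′≤T d≤T) (block T s i (x + 2 ^ i) d d′ 1≤s d≤T d′≤T))
      where
      lem₁ : ∀ x y → x + y + y ≡ x + (y + (y + 0))
      lem₁ = solve-∀
      lem₂ : ∀ s a b a′ b′ d d′ → s * (a * d + b * d′) + s * (a′ * d′ + b′ * d) ≡ s * ((a + b′) * d + (b + a′) * d′)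
      lem₂ = solve-∀

  -- Two digits reach only 2T, one short of the largest base-2^k digit 2T + 1 that will be needed;
  -- hence the third.
  three-digits : ∀ T t → 1 ≤ T → t ≤ suc (T + T) →
                 ∃[ d₁ ] ∃[ d₂ ] ∃[ d₃ ] (d₁ ≤ T × d₂ ≤ T × d₃ ≤ T × t ≡ d₁ + d₂ + d₃)
  three-digits T t 1≤T t≤ with t ≤? T
  ... | yes t≤T = t , 0 , 0 , t≤T , z≤n , z≤n , sym (trans (+-identityʳ (t + 0)) (+-identityʳ t))
  ... | no t≰T with t ∸ T ≤? T
  ...   | yes t-T≤T = T , t ∸ T , 0 , ≤-refl , t-T≤T , z≤n ,
          sym (trans (+-identityʳ _) (m+[n∸m]≡n (<⇒≤ (≰⇒> t≰T))))
  ...   | no t-T≰T = T , T , 1 , ≤-refl , ≤-refl , 1≤T , ≤-antisym (subst (t ≤_) (+-comm 1 (T + T)) t≤)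
          (subst₂ _≤_ (lem T) (m∸n+n≡m (<⇒≤ (≰⇒> t≰T))) (+-monoˡ-≤ T (≰⇒> t-T≰T)))
    where
    lem : ∀ T → suc T + T ≡ T + T + 1
    lem = solve-∀

  n<2^n : ∀ n → n < 2 ^ n
  n<2^n zero = ≤-refl
  n<2^n (suc n) = subst (suc (suc n) ≤_) (cong (2 ^ n +_) (sym (+-identityʳ (2 ^ n)))) (+-mono-≤ (m^n>0 2 n) (n<2^n n))

  -- In terms of the weights e m and multiplicities < L m, the even m = 2l contribute 2 (2l)^k and the odd m = 2l + 1
  -- contribute (2l + 1)^k.
  module Large (k : ℕ) (2≤k : 2 ≤ k) where

    open ThueMorse k

    -- `T` and `b` are the largest multiplicities for even and for odd m. `R` is both the base of
    -- the digit expansions and the ratio of (2l)^k to l^k.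
    T b R : ℕ
    T = pred (2 ^ (k ∸ 1))
    b = pred (2 ^ k)
    R = 2 ^ k

    sucT : suc T ≡ 2 ^ (k ∸ 1)
    sucT = suc-pred (2 ^ (k ∸ 1)) {{m^n≢0 2 (k ∸ 1)}}

    sucb : suc b ≡ R
    sucb = suc-pred R {{m^n≢0 2 k}}

    R≡2T+2 : R ≡ suc (suc (T + T))
    R≡2T+2 = begin
      2 ^ k                   ≡⟨ cong (2 ^_) (m+[n∸m]≡n (<⇒≤ 2≤k)) ⟨
      2 * 2 ^ (k ∸ 1)         ≡⟨ cong (2 *_) sucT ⟨
      2 * suc T               ≡⟨ lem T ⟩
      suc (suc (T + T))       ∎
      where
      open ≡-Reasoning
      lem : ∀ T → 2 * suc T ≡ suc (suc (T + T))
      lem = solve-∀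

    1≤T : 1 ≤ T
    1≤T = s≤s⁻¹ (subst (2 ≤_) (sym sucT) (^-monoʳ-≤ 2 (∸-monoˡ-≤ 1 2≤k)))

    1≤b : 1 ≤ b
    1≤b = s≤s⁻¹ (subst (2 ≤_) (sym (trans sucb R≡2T+2)) (s≤s (s≤s z≤n)))

    C : ℕ
    C = proj₁ α-β-const

    1≤C : 1 ≤ C
    1≤C = proj₁ (proj₂ α-β-const)

    -- Three blocks of 2^k indices starting at x₀ end exactly at 2 x₀, so the scales 2^a give
    -- adjacent, disjoint ranges.
    x₀ : ℕ
    x₀ = 3 * 2 ^ k

    private
      x₁ = x₀ + 2 ^ k
      x₂ = x₁ + 2 ^ k
      K = T * (β k x₀ + β k x₁ + β k x₂)

      -- Complementary digits d and T - d make the value affine in d, with slope C independent of x.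
      pair : ∀ x d → d ≤ T → α k x * d + β k x * (T ∸ d) ≡ T * β k x + C * d
      pair x d d≤T = trans (cong (λ z → z * d + β k x * (T ∸ d)) (proj₂ (proj₂ α-β-const) x))
        (trans (lem (β k x) C d (T ∸ d)) (cong (λ z → z * β k x + C * d) (m+[n∸m]≡n d≤T)))
        where
        lem : ∀ β C d e → (β + C) * d + β * e ≡ (d + e) * β + C * d
        lem = solve-∀

      triple : ∀ s t → 1 ≤ s → t ≤ suc (T + T) → Rep (_^ k) T (s * x₀) (s * (2 * x₀)) (s ^ k * (K + C * t))
      triple s t 1≤s t≤ with three-digits T t 1≤T t≤
      ... | d₁ , d₂ , d₃ , d₁≤T , d₂≤T , d₃≤T , refl =
        subst₂ (Rep (_^ k) T (s * x₀)) (cong (s *_) (range (2 ^ k)))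
          (trans (cong₂ (λ u v → s ^ k * u + v) (pair x₂ d₃ d₃≤T)
              (cong₂ (λ u v → s ^ k * u + s ^ k * v) (pair x₁ d₂ d₂≤T) (pair x₀ d₁ d₁≤T)))
            (lem (s ^ k) T (β k x₀) (β k x₁) (β k x₂) C d₁ d₂ d₃))
          (Rep-++ (Rep-++ (block T s k x₀ d₁ (T ∸ d₁) 1≤s d₁≤T (m∸n≤m T d₁))
                          (block T s k x₁ d₂ (T ∸ d₂) 1≤s d₂≤T (m∸n≤m T d₂)))
                  (block T s k x₂ d₃ (T ∸ d₃) 1≤s d₃≤T (m∸n≤m T d₃)))
        where
        range : ∀ r → 3 * r + r + r + r ≡ 2 * (3 * r)
        range = solve-∀
        lem : ∀ s T b₀ b₁ b₂ C d₁ d₂ d₃ →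
              s * (T * b₂ + C * d₃) + (s * (T * b₁ + C * d₂) + s * (T * b₀ + C * d₁))
              ≡ s * (T * (b₀ + b₁ + b₂) + C * (d₁ + d₂ + d₃))
        lem = solve-∀

    -- Write t in base R. As (2^A)^k = R^A, the range of scale 2^A realizes digit A of t, and the
    -- smaller scales realize the lower digits. The digit-independent amounts are collected in u.
    even-progression : ∀ A → ∃[ u ] (∀ t → t < R ^ A → Rep (_^ k) T x₀ (2 ^ A * x₀) (u + C * t))
    even-progression zero = 0 , λ { zero _ → subst₂ (Rep (_^ k) T x₀) (sym (+-identityʳ x₀)) (sym (*-zeroʳ C)) nil
                                  ; (suc t) (s≤s ()) }
    even-progression (suc A) with even-progression A
    ... | u , H = u + R ^ A * K , λ t t< →
      let instance _ = m^n≢0 R A {{m^n≢0 2 k}}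
          q = t / R ^ A
          q≤ : q ≤ suc (T + T)
          q≤ = s≤s⁻¹ (subst (suc q ≤_) R≡2T+2 (m<n*o⇒m/o<n t<))
      in subst₂ (Rep (_^ k) T x₀) (lem₁ (2 ^ A) x₀)
        (trans (cong (λ z → z * (K + C * q) + (u + C * (t % R ^ A))) (powers A))
          (trans (lem₂ (R ^ A) K C q u (t % R ^ A)) (cong (λ z → u + R ^ A * K + C * z) (sym (m≡m%n+[m/n]*n t (R ^ A))))))
        (Rep-++ (H (t % R ^ A) (m%n<n t (R ^ A))) (triple (2 ^ A) q (m^n>0 2 A) q≤))
      where
      powers : ∀ A → (2 ^ A) ^ k ≡ R ^ A
      powers A = trans (^-*-assoc 2 A k) (trans (cong (2 ^_) (*-comm A k)) (sym (^-*-assoc 2 k A)))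
      lem₁ : ∀ s x → s * (2 * x) ≡ 2 * s * x
      lem₁ = solve-∀
      lem₂ : ∀ r K C q u z → r * (K + C * q) + (u + C * z) ≡ u + r * K + C * (z + q * r)
      lem₂ = solve-∀

    odd^ : ℕ → ℕ
    odd^ l = (2 * l + 1) ^ k

    -- `M` is the step of the even progression after multiplication by 2R. Since 2c = M, the index l
    -- = c z stands for the odd number M z + 1.
    c M : ℕ
    c = R * C
    M = 2 * c

    private
      1≤R : 1 ≤ R
      1≤R = m^n>0 2 k

      1≤c : 1 ≤ c
      1≤c = *-mono-≤ 1≤R 1≤C

      1≤M : 1 ≤ M
      1≤M = *-mono-≤ {1} {2} (s≤s z≤n) 1≤c

    -- The odd numbers M j + 1 with 1 ≤ j ≤ r have k-th powers congruent to 1 modulo M, so taking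
    -- each once gives residue r. All other multiplicities, including that at l = 0, are 0.
    odd-residue : ∀ i r → r ≤ i → ∃[ q ] Rep odd^ b 0 (suc (c * i)) (r + M * q)
    odd-residue zero zero _ = 0 , subst₂ (Rep odd^ b 0) (cong suc (sym (*-zeroʳ c))) (sym (*-zeroʳ M)) (snoc 0 z≤n nil)
    odd-residue (suc i) r r≤ with r ≤? i
    ... | yes r≤i with odd-residue i r r≤i
    ...   | q , s = q , Rep-pad-≤ (s≤s (*-monoʳ-≤ c (n≤1+n i))) s
    odd-residue (suc i) r r≤ | no r≰i with odd-residue i i ≤-refl | ^-residue M (suc i) k
    ...   | q , s | q′ , eq = q′ + q , subst (Rep odd^ b 0 (suc (c * suc i)))
          (trans (cong (λ z → z + 0 + (i + M * q)) (trans (cong (λ z → (z + 1) ^ k) (sym (*-assoc 2 c (suc i)))) eq))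
            (trans (lem i M q q′) (cong (_+ M * (q′ + q)) (≤-antisym (≰⇒> r≰i) r≤))))
          (snoc 1 1≤b (Rep-pad-≤ (subst (suc (c * i) ≤_) (sym (*-suc c i)) (+-monoˡ-≤ (c * i) 1≤c)) s))
      where
      lem : ∀ i M q q′ → 1 + M * q′ + 0 + (i + M * q) ≡ suc i + M * (q′ + q)
      lem = solve-∀

    record Represented (H hi n : ℕ) : Set where
      constructor represented
      field
        {n₁ n₂} : ℕ
        evens : Rep (_^ k) T x₀ H n₁
        odds  : Rep odd^ b 0 hi n₂
        sum   : n ≡ 2 * R * n₁ + n₂

    Interval : ℕ → ℕ → ℕ → ℕ → Set
    Interval H u hi Λ = ∀ y → y < Λ → Represented H hi (u + y)

    hi₀ : ℕ
    hi₀ = suc (c * M)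

    -- Odd powers fix the residue of y modulo M but also contribute M q, with q depending on the
    -- residue. The interval starts far enough out, by Q ≥ q, that the even progression can supply
    -- the missing Q - q + y / M steps; A makes R^A exceed this number, by n < 2^n.
    initial-interval : ∃[ H ] ∃[ u ] Interval H u hi₀ (odd^ hi₀)
    initial-interval with even-progression (largest {odd^} {b} hi₀ + odd^ hi₀)
    ... | u , E = 2 ^ A * x₀ , 2 * R * u + M * Q , λ y y<Λ →
      let instance _ = >-nonZero 1≤M
          r = y % M
          y′ = y / M
          q , O = odd-residue M r (<⇒≤ (m%n<n y M))
          q≤Q : q ≤ Q
          q≤Q = ≤-trans (subst (_≤ M * q) (*-identityˡ q) (*-monoˡ-≤ q 1≤M))
                        (≤-trans (m≤n+m (M * q) r) (Rep-bound O))
          t<R^A : Q ∸ q + y′ < R ^ A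
          t<R^A = <-trans (+-mono-≤-< (m∸n≤m Q q) (≤-<-trans (m/n≤m y M) y<Λ))
                    (<-≤-trans (n<2^n A) (^-monoˡ-≤ A 2≤R))
      in represented (E (Q ∸ q + y′) t<R^A) O
          (trans (cong (λ z → 2 * R * u + M * z + y) (sym (m∸n+n≡m q≤Q)))
            (trans (cong (λ z → 2 * R * u + M * (Q ∸ q + q) + z) (m≡m%n+[m/n]*n y M))
              (lem R C u (Q ∸ q) q y′ r)))
      where
      Q = largest {odd^} {b} hi₀
      A = Q + odd^ hi₀
      2≤R : 2 ≤ R
      2≤R = subst (2 ≤_) (sym R≡2T+2) (s≤s (s≤s z≤n))
      lem : ∀ R C u z q y r → 2 * R * u + 2 * (R * C) * (z + q) + (r + y * (2 * (R * C)))
            ≡ 2 * R * (u + C * (z + y)) + (r + 2 * (R * C) * q)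
      lem = solve-∀

    -- Up to b = R - 1 copies of `odd^ hi` stretch an interval of that length by the factor R. This
    -- suffices because 2 hi + 3 ≤ 2 (2 hi + 1) for hi ≥ 1.
    extend-interval : ∀ {H u} hi → 1 ≤ hi → Interval H u hi (odd^ hi) → Interval H u (suc hi) (odd^ (suc hi))
    extend-interval {H} {u} hi 1≤hi I y y<Λ =
      let instance _ = m^n≢0 (2 * hi + 1) k {{>-nonZero (m≤n+m 1 (2 * hi))}}
          i = y / odd^ hi
          represented {n₁} {n₂} E O eq = I (y % odd^ hi) (m%n<n y (odd^ hi))
          i≤b : i ≤ b
          i≤b = s≤s⁻¹ (subst (suc i ≤_) (sym sucb) (m<n*o⇒m/o<n (<-≤-trans y<Λ growth)))
      in represented E (snoc i i≤b O) (trans (cong (u +_) (m≡m%n+[m/n]*n y (odd^ hi)))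
           (trans (lem₁ u (y % odd^ hi) (i * odd^ hi)) (trans (cong (i * odd^ hi +_) eq) (lem₂ (i * odd^ hi) (2 * R * n₁) n₂))))
      where
      growth : odd^ (suc hi) ≤ R * odd^ hi
      growth = subst (odd^ (suc hi) ≤_) (^-distribʳ-* k 2 (2 * hi + 1))
        (^-monoˡ-≤ k (subst₂ _≤_ (lem₃ hi) (lem₄ hi) (+-monoʳ-≤ (2 * hi + 2) (≤-trans 1≤hi (m≤m+n hi (hi + 0))))))
        where
        lem₃ : ∀ h → 2 * h + 2 + 1 ≡ 2 * suc h + 1
        lem₃ = solve-∀
        lem₄ : ∀ h → 2 * h + 2 + 2 * h ≡ 2 * (2 * h + 1)
        lem₄ = solve-∀
      lem₁ : ∀ u r z → u + (r + z) ≡ z + (u + r)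
      lem₁ = solve-∀
      lem₂ : ∀ z e o → z + (e + o) ≡ e + (z + o)
      lem₂ = solve-∀

    -- The start u and the even range H stay fixed while the length grows beyond n after n
    -- extensions.
    all-large : ∃[ H ] ∃[ u ] (∀ n → u ≤ n → ∃[ hi ] Represented H hi n)
    all-large with initial-interval
    ... | H , u , I₀ = H , u , λ n u≤n → n + hi₀ ,
      subst (Represented H (n + hi₀)) (m+[n∸m]≡n u≤n) (grow n (n ∸ u) (≤-<-trans (m∸n≤m n u) (n<odd^ n)))
      where
      grow : ∀ d → Interval H u (d + hi₀) (odd^ (d + hi₀))
      grow zero = I₀
      grow (suc d) = extend-interval (d + hi₀) (≤-trans (s≤s z≤n) (m≤n+m hi₀ d)) (grow d)
      n<odd^ : ∀ n → n < odd^ (n + hi₀)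
      n<odd^ n = ≤-trans (s≤s (m≤m+n n hi₀)) (≤-trans
        (subst (_≤ 2 * (n + hi₀) + 1) (+-comm (n + hi₀) 1) (+-monoˡ-≤ 1 (m≤m+n (n + hi₀) _)))
        (subst (_≤ odd^ (n + hi₀)) (^-identityʳ _)
          (^-monoʳ-≤ (2 * (n + hi₀) + 1) {{>-nonZero (m≤n+m 1 (2 * (n + hi₀)))}} (<⇒≤ 2≤k))))

-- Partitions into odd k-th powers are negligible among all partitions into k-th powers.

module Growth where

  open import Defs using (p; partsBounded)
  open Series
  open Partitions
  open SignedCount
  open import Data.Bool as Bool using (Bool; true; false; if_then_else_; _∨_; not)
  open import Data.Bool.Properties using (¬-not)
  open import Data.Nat as ℕ using (ℕ; zero; suc; z≤n; s≤s; _^_; _∸_; _≡ᵇ_; _⊓_)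
  import Data.Nat.Properties as ℕ
  open import Data.Integer using (ℤ; +_; 0ℤ; 1ℤ; _+_; _-_; -_; _*_; _≤_; +≤+)
  open import Data.Integer.Properties 
  open import Data.Integer.Tactic.RingSolver using (solve-∀)
  open import Data.Nat.Induction using (<-rec)
  open import Data.List using (List; []; _∷_)
  open import Data.Product using (_,_; _×_; ∃-syntax)
  open import Relation.Nullary using (yes; no; contradiction)
  open import Relation.Binary.PropositionalEquality hiding ([_]; J)

  +≥0 : ∀ n → 0ℤ ≤ + n
  +≥0 n = +≤+ z≤n

  *-mono-≤-nonNeg : ∀ {a b c d} → 0ℤ ≤ a → 0ℤ ≤ d → a ≤ b → c ≤ d → a * c ≤ b * d
  *-mono-≤-nonNeg {+ a} {b} {c} {+ d} _ _ a≤b c≤d = ≤-trans (*-monoˡ-≤-nonNeg (+ a) c≤d) (*-monoʳ-≤-nonNeg (+ d) a≤b)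

  *-nonNeg : ∀ {a b} → 0ℤ ≤ a → 0ℤ ≤ b → 0ℤ ≤ a * b
  *-nonNeg {a} {b} 0≤a 0≤b = *-mono-≤-nonNeg {0ℤ} {a} {0ℤ} {b} ≤-refl 0≤b 0≤a 0≤b

  x≤x+y : ∀ {x y} → 0ℤ ≤ y → x ≤ x + y
  x≤x+y {x} {y} 0≤y = subst (_≤ x + y) (+-identityʳ x) (+-monoʳ-≤ x 0≤y)

  Σℤ-mono : {A : Set} {g h : A → ℤ} → (∀ x → g x ≤ h x) → (xs : List A) → Σℤ g xs ≤ Σℤ h xs
  Σℤ-mono g≤h [] = ≤-refl
  Σℤ-mono g≤h (x ∷ xs) = +-mono-≤ (g≤h x) (Σℤ-mono g≤h xs)

  Σℤ-nonNeg : {A : Set} {g : A → ℤ} → (∀ x → 0ℤ ≤ g x) → (xs : List A) → 0ℤ ≤ Σℤ g xs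
  Σℤ-nonNeg 0≤g [] = ≤-refl
  Σℤ-nonNeg 0≤g (x ∷ xs) = +-mono-≤ (0≤g x) (Σℤ-nonNeg 0≤g xs)

  weight-nonNeg : ∀ {w} → (∀ y → 0ℤ ≤ w y) → ∀ xs → 0ℤ ≤ weight w xs
  weight-nonNeg 0≤w [] = +≥0 1
  weight-nonNeg 0≤w (y ∷ ys) = *-nonNeg (0≤w y) (weight-nonNeg 0≤w ys)

  weight-mono : ∀ {w w′} → (∀ y → 0ℤ ≤ w y) → (∀ y → w y ≤ w′ y) → ∀ xs → weight w xs ≤ weight w′ xs
  weight-mono 0≤w w≤w′ [] = ≤-refl
  weight-mono 0≤w w≤w′ (y ∷ ys) = *-mono-≤-nonNeg (0≤w y)
    (weight-nonNeg (λ z → ≤-trans (0≤w z) (w≤w′ z)) ys) (w≤w′ y) (weight-mono 0≤w w≤w′ ys)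

  if-1-nonNeg : ∀ b → 0ℤ ≤ (if b then 1ℤ else 0ℤ)
  if-1-nonNeg true = +≥0 1
  if-1-nonNeg false = ≤-refl

  if-1-≤ : ∀ b → (if b then 1ℤ else 0ℤ) ≤ 1ℤ
  if-1-≤ true = ≤-refl
  if-1-≤ false = +≥0 1

  sh-step : ∀ a f n → (∀ i → 0ℤ ≤ f i) → (∀ i → i ℕ.< n → f i ≤ f (suc i)) → sh (suc a) f n ≤ sh (suc a) f (suc n)
  sh-step zero f zero f≥0 f↑ = f≥0 0
  sh-step zero f (suc n) f≥0 f↑ = f↑ n ℕ.≤-refl
  sh-step (suc a) f zero f≥0 f↑ = ≤-refl
  sh-step (suc a) f (suc n) f≥0 f↑ = sh-step a f n f≥0 (λ i i<n → f↑ i (ℕ.m≤n⇒m≤1+n i<n))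

  sh-≤-const : ∀ a f g c n → 0ℤ ≤ c → 1 ℕ.≤ a → (∀ i → i ℕ.< n → f i ≤ g i + c) → sh a f n ≤ sh a g n + c
  sh-≤-const a f g c n 0≤c 1≤a f≤ = ≤-trans (sh-mono-< a n 1≤a f≤)
    (subst (_≤ sh a g n + c) (sym (sh-add a g (λ _ → c) n)) (+-monoʳ-≤ (sh a g n) (const≤ a n)))
    where
    const≤ : ∀ a n → sh a (λ _ → c) n ≤ c
    const≤ zero n = ≤-refl
    const≤ (suc a) zero = 0≤c
    const≤ (suc a) (suc n) = const≤ a n

  <-induction : (Q : ℕ → Set) → (∀ n → (∀ i → i ℕ.< n → Q i) → Q n) → ∀ n → Q n
  <-induction Q step = <-rec Q (λ n r → step n (λ i i<n → r i<n))

  x+x≤y+y⇒x≤y : ∀ {x y} → x + x ≤ y + y → x ≤ y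
  x+x≤y+y⇒x≤y {x} {y} h with x ≤? y
  ... | yes x≤y = x≤y
  ... | no x≰y = contradiction h (<⇒≱ (+-mono-< (≰⇒> x≰y) (≰⇒> x≰y)))

  -- (m+1)^k = (m+1)^(k-1) + m (m+1)^(k-1), where k ≥ 2 bounds the first term below by m. This
  -- unbounded gap is the room for trading parts.
  ^-gap : ∀ k m → 2 ℕ.≤ k → 1 ℕ.≤ m → m ^ k ℕ.+ m ℕ.≤ suc m ^ k
  ^-gap (suc zero) m (s≤s ()) _
  ^-gap (suc (suc j)) m _ _ = subst (ℕ._≤ suc m ^ suc (suc j)) (ℕ.+-comm m (m ^ suc (suc j)))
    (ℕ.+-mono-≤ (ℕ.≤-trans (ℕ.n≤1+n m) (subst (ℕ._≤ suc m ^ suc j) (ℕ.*-identityʳ (suc m)) (ℕ.*-monoʳ-≤ (suc m) (ℕ.m^n>0 (suc m) j))))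
                (ℕ.*-monoʳ-≤ m (ℕ.^-monoˡ-≤ (suc j) (ℕ.n≤1+n m))))

  module Asymptotics (k : ℕ) (2≤k : 2 ℕ.≤ k) where

    1≤k : 1 ℕ.≤ k
    1≤k = ℕ.<⇒≤ 2≤k

    open Signed k 1≤k hiding (N; U; L; e; D)

    -- Allows the odd powers and the one even power 2^k, whose free multiplicity makes `A` outgrow
    -- `O`.
    two-or-odd : ℕ → ℤ
    two-or-odd y = if isOdd y ∨ (y ≡ᵇ 2 ^ k) then 1ℤ else 0ℤ

    P A : ℕ → Ser
    P = G (λ _ → 1ℤ)
    A = G two-or-odd

    1≤m^k : ∀ m → 1 ℕ.≤ suc m ^ k
    1≤m^k m = ℕ.≤-trans (s≤s z≤n) (m≤m^k (suc m))

    if-0-nonNeg : ∀ {c : ℕ → ℤ} → (∀ y → 0ℤ ≤ c y) → ∀ y → 0ℤ ≤ wt c y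
    if-0-nonNeg 0≤c y with Defs.isKthPower k y
    ... | true = 0≤c y
    ... | false = ≤-refl

    G-nonNeg : ∀ {c} → (∀ y → 0ℤ ≤ c y) → ∀ x n → 0ℤ ≤ G c x n
    G-nonNeg 0≤c x n = Σℤ-nonNeg (weight-nonNeg (if-0-nonNeg 0≤c)) (partsBounded n n (x ^ k))

    G-suc : ∀ c x n → G c (suc x) n ≡ G c x n + c (suc x ^ k) * sh (suc x ^ k) (G c (suc x)) n
    G-suc c x n = trans (lem _ (c (suc x ^ k) * sh (suc x ^ k) (G c (suc x)) n)) (cong (_+ c (suc x ^ k) * sh (suc x ^ k) (G c (suc x)) n) (G-B c x n))
      where
      lem : ∀ x y → x ≡ (x - y) + y
      lem = solve-∀

    G-suc-1 : ∀ c x n → c (suc x ^ k) ≡ 1ℤ → G c (suc x) n ≡ G c x n + sh (suc x ^ k) (G c (suc x)) n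
    G-suc-1 c x n eq = trans (G-suc c x n) (cong (λ z → G c x n + z) (trans (cong (_* sh (suc x ^ k) (G c (suc x)) n) eq) (*-identityˡ _)))

    G-suc-0 : ∀ c x n → c (suc x ^ k) ≡ 0ℤ → G c (suc x) n ≡ G c x n
    G-suc-0 c x n eq = trans (G-suc c x n) (trans (cong (λ z → G c x n + z * sh (suc x ^ k) (G c (suc x)) n) eq) (+-identityʳ _))

    G-mono-x : ∀ {c} → (∀ y → 0ℤ ≤ c y) → ∀ d x n → G c x n ≤ G c (d ℕ.+ x) n
    G-mono-x 0≤c zero x n = ≤-refl
    G-mono-x {c} 0≤c (suc d) x n = ≤-trans (G-mono-x 0≤c d x n)
      (subst (G c (d ℕ.+ x) n ≤_) (sym (G-suc c (d ℕ.+ x) n))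
        (x≤x+y (*-nonNeg (0≤c (suc (d ℕ.+ x) ^ k)) (sh-nonNeg (suc (d ℕ.+ x) ^ k) (G c (suc d ℕ.+ x)) n
          (λ i _ → G-nonNeg 0≤c (suc d ℕ.+ x) i)))))

    odd-only-nonNeg : ∀ y → 0ℤ ≤ odd-only y
    odd-only-nonNeg y = if-1-nonNeg (isOdd y)

    two-or-odd-nonNeg : ∀ y → 0ℤ ≤ two-or-odd y
    two-or-odd-nonNeg y = if-1-nonNeg (isOdd y ∨ (y ≡ᵇ 2 ^ k))

    O≥0 : ∀ x n → 0ℤ ≤ O x n
    O≥0 = G-nonNeg odd-only-nonNeg

    A≥0 : ∀ x n → 0ℤ ≤ A x n
    A≥0 = G-nonNeg two-or-odd-nonNeg

    P≥0 : ∀ x n → 0ℤ ≤ P x n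
    P≥0 = G-nonNeg (λ _ → +≥0 1)

    A≤P : ∀ x n → A x n ≤ P x n
    A≤P x n = Σℤ-mono (weight-mono (if-0-nonNeg two-or-odd-nonNeg) le) (partsBounded n n (x ^ k))
      where
      le : ∀ y → wt two-or-odd y ≤ wt (λ _ → 1ℤ) y
      le y with Defs.isKthPower k y
      ... | true = if-1-≤ (isOdd y ∨ (y ≡ᵇ 2 ^ k))
      ... | false = ≤-refl

    P-suc : ∀ x n → P (suc x) n ≡ P x n + sh (suc x ^ k) (P (suc x)) n
    P-suc x n = G-suc-1 _ x n refl

    odd-only-odd : ∀ x → isOdd x ≡ true → odd-only (x ^ k) ≡ 1ℤ
    odd-only-odd x o rewrite isOdd-^ x k 1≤k | o = refl

    odd-only-even : ∀ x → isOdd x ≡ false → odd-only (x ^ k) ≡ 0ℤ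
    odd-only-even x o rewrite isOdd-^ x k 1≤k | o = refl

    two-or-odd-odd : ∀ x → isOdd x ≡ true → two-or-odd (x ^ k) ≡ 1ℤ
    two-or-odd-odd x o rewrite isOdd-^ x k 1≤k | o = refl

    ≡ᵇ-refl : ∀ n → (n ≡ᵇ n) ≡ true
    ≡ᵇ-refl zero = refl
    ≡ᵇ-refl (suc n) = ≡ᵇ-refl n

    <⇒≡ᵇ-false : ∀ m n → m ℕ.< n → (n ≡ᵇ m) ≡ false
    <⇒≡ᵇ-false zero (suc n) _ = refl
    <⇒≡ᵇ-false (suc m) (suc n) (s≤s m<n) = <⇒≡ᵇ-false m n m<n

    two-or-odd-2 : two-or-odd (2 ^ k) ≡ 1ℤ
    two-or-odd-2 rewrite isOdd-^ 2 k 1≤k | ≡ᵇ-refl (2 ^ k) = refl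

    two-or-odd-even : ∀ x → 2 ℕ.< x → isOdd x ≡ false → two-or-odd (x ^ k) ≡ 0ℤ
    two-or-odd-even x 2<x o rewrite isOdd-^ x k 1≤k | o | <⇒≡ᵇ-false (2 ^ k) (x ^ k) (ℕ.^-monoˡ-< k 2<x) = refl

    O-one : ∀ n → O 1 n ≡ 1ℤ
    O-one n = trans (G-suc-1 odd-only 0 n (odd-only-odd 1 refl))
      (trans (cong₂ (λ a z → a + sh z (O 1) n) (G-zero odd-only n) (ℕ.^-zeroˡ k)) (go n))
      where
      go : ∀ n → δ n + sh 1 (O 1) n ≡ 1ℤ
      go zero = refl
      go (suc n) = trans (+-identityˡ (O 1 n)) (O-one n)

    A-one : ∀ n → A 1 n ≡ 1ℤ
    A-one n = trans (G-suc-1 two-or-odd 0 n (two-or-odd-odd 1 refl))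
      (trans (cong₂ (λ a z → a + sh z (A 1) n) (G-zero two-or-odd n) (ℕ.^-zeroˡ k)) (go n))
      where
      go : ∀ n → δ n + sh 1 (A 1) n ≡ 1ℤ
      go zero = refl
      go (suc n) = trans (+-identityˡ (A 1 n)) (A-one n)

    O-two : ∀ n → O 2 n ≡ 1ℤ
    O-two n = trans (G-suc-0 odd-only 1 n (odd-only-even 2 refl)) (O-one n)

    O≥1 : ∀ d n → 1ℤ ≤ O (d ℕ.+ 2) n
    O≥1 d n = subst (_≤ O (d ℕ.+ 2) n) (O-two n) (G-mono-x odd-only-nonNeg d 2 n)

    -- A part 1 can always be added. Formally, the all-ones case is constant, and each further odd
    -- part adds a shift, which preserves monotonicity by induction on n.
    O-mono : ∀ d n → O (d ℕ.+ 2) n ≤ O (d ℕ.+ 2) (suc n)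
    O-mono zero n = ≤-reflexive (trans (O-two n) (sym (O-two (suc n))))
    O-mono (suc d) with isOdd (suc (d ℕ.+ 2)) in o
    ... | false = λ n → subst₂ _≤_ (sym (even n)) (sym (even (suc n))) (O-mono d n)
      where even = λ n → G-suc-0 odd-only (d ℕ.+ 2) n (odd-only-even (suc (d ℕ.+ 2)) o)
    ... | true = <-induction _ λ n ih → subst₂ _≤_ (sym (odd n)) (sym (odd (suc n)))
        (+-mono-≤ (O-mono d n) (subst (λ a → sh a (O m) n ≤ sh a (O m) (suc n))
          (ℕ.suc-pred (m ^ k) {{ℕ.m^n≢0 m k}}) (sh-step (ℕ.pred (m ^ k)) (O m) n (O≥0 m) ih)))
      where
      m = suc (d ℕ.+ 2)
      odd = λ n → G-suc-1 odd-only (d ℕ.+ 2) n (odd-only-odd m o)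

    O-mono-+ : ∀ d e n → O (d ℕ.+ 2) n ≤ O (d ℕ.+ 2) (e ℕ.+ n)
    O-mono-+ d zero n = ≤-refl
    O-mono-+ d (suc e) n = ≤-trans (O-mono-+ d e n) (O-mono d (e ℕ.+ n))

    -- From bound 2 on, 2^k is an admissible part of `A` and the only one that `O` lacks.
    A-B : ∀ d → B 1ℤ (2 ^ k) (A (d ℕ.+ 2)) ≗ O (d ℕ.+ 2)
    A-B zero n = trans (cong (λ c → B c (2 ^ k) (A 2) n) (sym two-or-odd-2))
      (trans (G-B two-or-odd 1 n) (trans (A-one n) (sym (O-two n))))
    A-B (suc d) n with isOdd (suc (d ℕ.+ 2)) in o
    ... | false = trans (B-cong′ 1ℤ (2 ^ k) (λ i → G-suc-0 two-or-odd (d ℕ.+ 2) i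
            (two-or-odd-even (suc (d ℕ.+ 2)) (s≤s (ℕ.m≤n+m 2 d)) o)) n)
          (trans (A-B d n) (sym (G-suc-0 odd-only (d ℕ.+ 2) n (odd-only-even (suc (d ℕ.+ 2)) o))))
    ... | true = B-inj 1ℤ (m ^ k) {B 1ℤ (2 ^ k) (A m)} {O m} n (1≤m^k (d ℕ.+ 2)) (λ i _ →
        trans (B-comm 1ℤ (m ^ k) 1ℤ (2 ^ k) (A m) i)
          (trans (B-cong′ 1ℤ (2 ^ k) A-odd i) (trans (A-B d i) (sym (O-odd i))))) n ℕ.≤-refl
      where
      m = suc (d ℕ.+ 2)
      A-odd : B 1ℤ (m ^ k) (A m) ≗ A (d ℕ.+ 2)
      A-odd i = trans (cong (λ c → B c (m ^ k) (A m) i) (sym (two-or-odd-odd m o))) (G-B two-or-odd (d ℕ.+ 2) i)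
      O-odd : B 1ℤ (m ^ k) (O m) ≗ O (d ℕ.+ 2)
      O-odd i = trans (cong (λ c → B c (m ^ k) (O m) i) (sym (odd-only-odd m o))) (G-B odd-only (d ℕ.+ 2) i)

    A≡O+ : ∀ d n → A (d ℕ.+ 2) n ≡ O (d ℕ.+ 2) n + sh (2 ^ k) (A (d ℕ.+ 2)) n
    A≡O+ d n = trans (lem (A (d ℕ.+ 2) n) (sh (2 ^ k) (A (d ℕ.+ 2)) n)) (cong (_+ sh (2 ^ k) (A (d ℕ.+ 2)) n) (A-B d n))
      where
      lem : ∀ x y → x ≡ (x - 1ℤ * y) + y
      lem = solve-∀

    -- Using the part 2^k from 0 to M - 1 times leaves M values of `O` at arguments ≥ n, each at
    -- least `O n` by monotonicity.
    M*O≤A : ∀ d M n → + M * O (d ℕ.+ 2) n ≤ A (d ℕ.+ 2) (M ℕ.* 2 ^ k ℕ.+ n)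
    M*O≤A d zero n = A≥0 (d ℕ.+ 2) n
    M*O≤A d (suc M) n = subst₂ _≤_ (lem (+ M) (O x n))
      (trans (cong (λ z → O x N + z) (sym (sh-small (2 ^ k) (A x) (M ℕ.* 2 ^ k ℕ.+ n))))
        (trans (cong (λ z → O x N + sh (2 ^ k) (A x) z) (sym (ℕ.+-assoc (2 ^ k) (M ℕ.* 2 ^ k) n)))
               (sym (A≡O+ d (suc M ℕ.* 2 ^ k ℕ.+ n)))))
      (+-mono-≤ (O-mono-+ d (2 ^ k ℕ.+ M ℕ.* 2 ^ k) n) (M*O≤A d M n))
      where
      x = d ℕ.+ 2
      N = suc M ℕ.* 2 ^ k ℕ.+ n
      lem : ∀ m o → o + m * o ≡ (1ℤ + m) * o
      lem = solve-∀

    M≤A : ∀ d M n → M ℕ.* 2 ^ k ℕ.≤ n → + M ≤ A (d ℕ.+ 2) n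
    M≤A d M n le = ≤-trans (subst (_≤ + M * O (d ℕ.+ 2) r) (*-identityʳ (+ M)) (*-monoˡ-≤-nonNeg (+ M) (O≥1 d r)))
      (subst (λ z → + M * O (d ℕ.+ 2) r ≤ A (d ℕ.+ 2) z) (ℕ.m+[n∸m]≡n le) (M*O≤A d M r))
      where r = n ∸ M ℕ.* 2 ^ k

    -- For parts m^k with m ≤ x there are polynomially many partitions, and allowing the part 2^k raises the degree.
    finite-parts : ∀ d M → ∃[ K ] (∀ n → + M * O (d ℕ.+ 2) n ≤ A (d ℕ.+ 2) n + + K)
    finite-parts zero M = M , λ n → subst (_≤ A 2 n + + M)
      (trans (+-identityˡ (+ M)) (trans (sym (*-identityʳ (+ M))) (cong (+ M *_) (sym (O-two n)))))
      (+-monoˡ-≤ (+ M) (A≥0 2 n))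
    finite-parts (suc d) M with isOdd (suc (d ℕ.+ 2)) in o
    ... | false with finite-parts d M
    ...   | K , le = K , λ n → subst₂ (λ a b → + M * a ≤ b + + K)
            (sym (G-suc-0 odd-only x n (odd-only-even (suc x) o)))
            (sym (G-suc-0 two-or-odd x n (two-or-odd-even (suc x) (s≤s (ℕ.m≤n+m 2 d)) o))) (le n)
      where x = d ℕ.+ 2
    -- The induction hypothesis is taken for 2M: once `A x n` ≥ K, the error K is absorbed, 2M O ≤
    -- 2A, and halving leaves no error.
    finite-parts (suc d) M | true with finite-parts d (M ℕ.+ M)
    ...   | K , le = K ℕ.* N , λ n → ≤-trans (bound n) (+-monoʳ-≤ (A m n) (+≤+ (ℕ.*-monoʳ-≤ K (ℕ.m⊓n≤n (suc n) N))))
      where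
      x = d ℕ.+ 2
      m = suc x
      N = K ℕ.* 2 ^ k
      double-M : ∀ n → + (M ℕ.+ M) * O x n ≡ + M * O x n + + M * O x n
      double-M n = trans (cong (_* O x n) (pos-+ M M)) (*-distribʳ-+ (O x n) (+ M) (+ M))
      -- Accumulated error of the recursion in n: at most K for each index below `N` and nothing
      -- from `N` on, hence bounded by K N.
      excess : ℕ → ℕ
      excess n = K ℕ.* (n ⊓ N)
      old : ∀ n → ∃[ κ ] (+ M * O x n ≤ A x n + + κ × κ ℕ.+ excess n ≡ excess (suc n))
      old n with n ℕ.<? N
      ... | yes n<N = K ,
        ≤-trans (subst (+ M * O x n ≤_) (sym (double-M n)) (x≤x+y (*-nonNeg {+ M} (+≥0 M) (O≥0 x n)))) (le n) ,
        trans (cong (λ z → K ℕ.+ K ℕ.* z) (ℕ.m≤n⇒m⊓n≡m (ℕ.<⇒≤ n<N)))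
          (trans (sym (ℕ.*-suc K n)) (cong (K ℕ.*_) (sym (ℕ.m≤n⇒m⊓n≡m n<N))))
      ... | no n≮N = 0 ,
        subst (+ M * O x n ≤_) (sym (+-identityʳ (A x n))) (x+x≤y+y⇒x≤y (subst (_≤ A x n + A x n) (double-M n)
          (≤-trans (le n) (+-monoʳ-≤ (A x n) (M≤A d K n (ℕ.≮⇒≥ n≮N)))))) ,
        cong (K ℕ.*_) (trans (ℕ.m≥n⇒m⊓n≡n (ℕ.≮⇒≥ n≮N)) (sym (ℕ.m≥n⇒m⊓n≡n (ℕ.m≤n⇒m≤1+n (ℕ.≮⇒≥ n≮N)))))
      bound : ∀ n → + M * O m n ≤ A m n + + excess (suc n)
      bound = <-induction _ λ n ih → let κ , le₀ , eq = old n in subst₂ _≤_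
        (trans (sym (*-distribˡ-+ (+ M) (O x n) (sh (m ^ k) (O m) n)))
          (cong (+ M *_) (sym (G-suc-1 odd-only x n (odd-only-odd m o)))))
        (trans (lem (A x n) (+ κ) (sh (m ^ k) (A m) n) (+ excess n))
          (cong₂ _+_ (sym (G-suc-1 two-or-odd x n (two-or-odd-odd m o)))
            (trans (sym (pos-+ κ (excess n))) (cong +_ eq))))
        (+-mono-≤ le₀ (subst (_≤ sh (m ^ k) (A m) n + + excess n) (sh-* (m ^ k) (+ M) (O m) n)
          (sh-≤-const (m ^ k) (λ i → + M * O m i) (A m) (+ excess n) n (+≥0 (excess n)) (1≤m^k x) λ i i<n →
            ≤-trans (ih i i<n) (+-monoʳ-≤ (A m i) (+≤+ (ℕ.*-monoʳ-≤ K (ℕ.⊓-monoˡ-≤ N i<n)))))))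
        where
        lem : ∀ a κ s t → (a + κ) + (s + t) ≡ (a + s) + (κ + t)
        lem = solve-∀

    -- d + 4, written in the form x + 2 of the arguments of O and A above.
    four+ : ℕ → ℕ
    four+ e = suc (suc e ℕ.+ 2)

    -- Σ q^(m^k) f over the even m with 4 ≤ m ≤ d + 3.
    even-terms : ℕ → Ser → Ser
    even-terms zero f n = 0ℤ
    even-terms (suc d) f n = even-terms d f n + (if isOdd (four+ d) then 0ℤ else sh (four+ d ^ k) f n)

    even-terms-odd : ∀ d f n → isOdd (four+ d) ≡ true → even-terms (suc d) f n ≡ even-terms d f n
    even-terms-odd d f n o = trans (cong (λ b → even-terms d f n + (if b then 0ℤ else sh (four+ d ^ k) f n)) o) (+-identityʳ _)

    even-terms-even : ∀ d f n → isOdd (four+ d) ≡ false → even-terms (suc d) f n ≡ even-terms d f n + sh (four+ d ^ k) f n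
    even-terms-even d f n o = cong (λ b → even-terms d f n + (if b then 0ℤ else sh (four+ d ^ k) f n)) o

    even-terms-cong : ∀ d {f g} → f ≗ g → even-terms d f ≗ even-terms d g
    even-terms-cong zero eq n = refl
    even-terms-cong (suc d) eq n = cong₂ (λ x y → x + (if isOdd (four+ d) then 0ℤ else y))
      (even-terms-cong d eq n) (sh-cong (four+ d ^ k) n (λ i _ → eq i))

    even-terms-+ : ∀ d f g n → even-terms d (λ i → f i + g i) n ≡ even-terms d f n + even-terms d g n
    even-terms-+ zero f g n = refl
    even-terms-+ (suc d) f g n = trans (cong₂ _+_ (even-terms-+ d f g n) (term (isOdd (four+ d))))
      (lem (even-terms d f n) (even-terms d g n) _ _)
      where
      term : ∀ b → (if b then 0ℤ else sh (four+ d ^ k) (λ i → f i + g i) n)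
             ≡ (if b then 0ℤ else sh (four+ d ^ k) f n) + (if b then 0ℤ else sh (four+ d ^ k) g n)
      term true = refl
      term false = sh-add (four+ d ^ k) f g n
      lem : ∀ a b c d → (a + b) + (c + d) ≡ (a + c) + (b + d)
      lem = solve-∀

    even-terms-sh : ∀ d a f n → even-terms d (sh a f) n ≡ sh a (even-terms d f) n
    even-terms-sh zero a f n = sym (sh-0 a n)
    even-terms-sh (suc d) a f n = trans (cong₂ _+_ (even-terms-sh d a f n) (term (isOdd (four+ d))))
      (sym (sh-add a (even-terms d f) _ n))
      where
      term : ∀ b → (if b then 0ℤ else sh (four+ d ^ k) (sh a f) n) ≡ sh a (λ i → if b then 0ℤ else sh (four+ d ^ k) f i) n
      term true = sym (sh-0 a n)
      term false = sh-comm (four+ d ^ k) a f n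

    even-terms-suc : ∀ d f n → (∀ i → 0ℤ ≤ f i) → even-terms d f n ≤ even-terms (suc d) f n
    even-terms-suc d f n f≥0 with isOdd (four+ d)
    ... | true = x≤x+y ≤-refl
    ... | false = x≤x+y (sh-nonNeg (four+ d ^ k) f n (λ i _ → f≥0 i))

    even-terms-nonNeg : ∀ d f n → (∀ i → 0ℤ ≤ f i) → 0ℤ ≤ even-terms d f n
    even-terms-nonNeg zero f n f≥0 = ≤-refl
    even-terms-nonNeg (suc d) f n f≥0 = ≤-trans (even-terms-nonNeg d f n f≥0) (even-terms-suc d f n f≥0)

    -- A partition counted on the left has exactly one even part m^k with m ≥ 4.
    even-terms≤P : ∀ d n → even-terms d (A (suc d ℕ.+ 2)) n ≤ P (suc d ℕ.+ 2) n
    even-terms≤P zero n = P≥0 3 n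
    even-terms≤P (suc d) n with isOdd (four+ d) Bool.≟ true
    -- An odd m adds no even term, but m^k may now occur repeatedly on both sides; hence the inner
    -- induction on n.
    ... | yes o = <-induction (λ i → even-terms (suc d) (A m) i ≤ P m i) step n
      where
      x = suc d ℕ.+ 2
      m = four+ d
      a = m ^ k
      step : ∀ n → (∀ i → i ℕ.< n → even-terms (suc d) (A m) i ≤ P m i) → even-terms (suc d) (A m) n ≤ P m n
      step n ih = begin
        even-terms (suc d) (A m) n
          ≡⟨ even-terms-odd d (A m) n o ⟩
        even-terms d (A m) n
          ≡⟨ even-terms-cong d (λ i → G-suc-1 two-or-odd x i (two-or-odd-odd m o)) n ⟩
        even-terms d (λ i → A x i + sh a (A m) i) n
          ≡⟨ even-terms-+ d (A x) (sh a (A m)) n ⟩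
        even-terms d (A x) n + even-terms d (sh a (A m)) n
          ≡⟨ cong (λ z → even-terms d (A x) n + z) (even-terms-sh d a (A m) n) ⟩
        even-terms d (A x) n + sh a (even-terms d (A m)) n
          ≤⟨ +-mono-≤ (even-terms≤P d n) (sh-mono-< a n (1≤m^k x)
               (λ i i<n → subst (_≤ P m i) (even-terms-odd d (A m) i o) (ih i i<n))) ⟩
        P x n + sh a (P m) n
          ≡⟨ P-suc x n ⟨
        P m n ∎
        where open ≤-Reasoning
    ... | no ¬o = begin
      even-terms (suc d) (A m) n
        ≡⟨ even-terms-even d (A m) n o ⟩
      even-terms d (A m) n + sh a (A m) n
        ≡⟨ cong (_+ sh a (A m) n) (even-terms-cong d (λ i → G-suc-0 two-or-odd x i
             (two-or-odd-even m (s≤s (s≤s (ℕ.≤-trans (s≤s z≤n) (ℕ.m≤n+m 2 d)))) o)) n) ⟩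
      even-terms d (A x) n + sh a (A m) n
        ≤⟨ +-mono-≤ (even-terms≤P d n) (sh-mono a n (λ i _ → A≤P m i)) ⟩
      P x n + sh a (P m) n
        ≡⟨ P-suc x n ⟨
      P m n ∎
      where
      open ≤-Reasoning
      x = suc d ℕ.+ 2
      m = four+ d
      a = m ^ k
      o = ¬-not ¬o

    -- Trading the part (m+1)^k for m^k, up to M - 1 parts 2^k and some parts 1.
    trade : ∀ d M m n → 1 ℕ.≤ m → M ℕ.* 2 ^ k ℕ.≤ m →
            + M * sh (suc m ^ k) (O (d ℕ.+ 2)) n ≤ sh (m ^ k) (A (d ℕ.+ 2)) n
    trade d M m n 1≤m le with suc m ^ k ℕ.≤? n
    ... | no n< = subst (_≤ sh (m ^ k) (A (d ℕ.+ 2)) n)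
        (trans (sym (*-zeroʳ (+ M))) (cong (+ M *_) (sym (sh-big (suc m ^ k) (O (d ℕ.+ 2)) n (ℕ.≰⇒> n<)))))
        (sh-nonNeg (m ^ k) (A (d ℕ.+ 2)) n (λ i _ → A≥0 (d ℕ.+ 2) i))
    ... | yes a≤n = begin
      + M * sh (suc m ^ k) (O x) n       ≡⟨ cong (+ M *_) (sh-∸ (suc m ^ k) (O x) n a≤n) ⟩
      + M * O x r                        ≤⟨ *-monoˡ-≤-nonNeg (+ M) (O-mono-+ d e r) ⟩
      + M * O x (e ℕ.+ r)                ≤⟨ M*O≤A d M (e ℕ.+ r) ⟩
      A x (M ℕ.* 2 ^ k ℕ.+ (e ℕ.+ r))    ≡⟨ sh-small (m ^ k) (A x) (M ℕ.* 2 ^ k ℕ.+ (e ℕ.+ r)) ⟨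
      sh (m ^ k) (A x) (m ^ k ℕ.+ (M ℕ.* 2 ^ k ℕ.+ (e ℕ.+ r))) ≡⟨ cong (sh (m ^ k) (A x)) n≡ ⟩
      sh (m ^ k) (A x) n                 ∎
      where
      open ≤-Reasoning
      x = d ℕ.+ 2
      r = n ∸ suc m ^ k
      room : m ^ k ℕ.+ M ℕ.* 2 ^ k ℕ.≤ suc m ^ k
      room = ℕ.≤-trans (ℕ.+-monoʳ-≤ (m ^ k) le) (^-gap k m 2≤k 1≤m)
      -- The part of the gap left over by M parts 2^k; it is filled with parts 1, through the
      -- monotonicity of `O`.
      e = suc m ^ k ∸ (m ^ k ℕ.+ M ℕ.* 2 ^ k)
      n≡ : m ^ k ℕ.+ (M ℕ.* 2 ^ k ℕ.+ (e ℕ.+ r)) ≡ n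
      n≡ = trans (sym (ℕ.+-assoc (m ^ k) (M ℕ.* 2 ^ k) (e ℕ.+ r)))
        (trans (sym (ℕ.+-assoc (m ^ k ℕ.+ M ℕ.* 2 ^ k) e r))
          (trans (cong (ℕ._+ r) (ℕ.m+[n∸m]≡n room)) (ℕ.m+[n∸m]≡n a≤n)))

    module _ (M : ℕ) where

      -- From m = J on, the gap between m^k and (m+1)^k has room for M parts 2^k, as `trade`
      -- requires.
      J : ℕ
      J = M ℕ.* 2 ^ k

      -- Σ q^(j^k) f over d consecutive j from J + 5, restricted to the odd ones.
      odd-terms : ℕ → Ser → Ser
      odd-terms zero f n = 0ℤ
      odd-terms (suc d) f n = odd-terms d f n + (if isOdd (four+ (d ℕ.+ J)) then 0ℤ else sh (suc (four+ (d ℕ.+ J)) ^ k) f n)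

      odd-terms-bound : ∀ z d n → + M * odd-terms d (O (z ℕ.+ 2)) n ≤ even-terms (d ℕ.+ J) (A (z ℕ.+ 2)) n
      odd-terms-bound z zero n = subst (_≤ even-terms J (A (z ℕ.+ 2)) n) (sym (*-zeroʳ (+ M)))
        (even-terms-nonNeg J (A (z ℕ.+ 2)) n (A≥0 (z ℕ.+ 2)))
      odd-terms-bound z (suc d) n = subst (_≤ even-terms (suc d ℕ.+ J) (A (z ℕ.+ 2)) n)
        (sym (*-distribˡ-+ (+ M) (odd-terms d (O (z ℕ.+ 2)) n) _)) (+-mono-≤ (odd-terms-bound z d n) (term (isOdd m)))
        where
        m = four+ (d ℕ.+ J)
        term : ∀ b → + M * (if b then 0ℤ else sh (suc m ^ k) (O (z ℕ.+ 2)) n) ≤ (if b then 0ℤ else sh (m ^ k) (A (z ℕ.+ 2)) n)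
        term true = ≤-reflexive (*-zeroʳ (+ M))
        term false = trade z M m n (s≤s z≤n) (ℕ.≤-trans (ℕ.m≤n+m J d) (ℕ.≤-trans (ℕ.m≤m+n (d ℕ.+ J) 2) (ℕ.≤-trans (ℕ.n≤1+n _) (ℕ.n≤1+n _))))

      -- By the largest part: it is bounded by `four+ J`, or it is one of the later odd powers and
      -- removing one copy leaves a partition counted by `O Y`.
      O-split : ∀ Y d n → four+ (d ℕ.+ J) ℕ.≤ Y → O (four+ (d ℕ.+ J)) n ≤ O (four+ J) n + odd-terms d (O Y) n
      O-split Y zero n _ = ≤-reflexive (sym (+-identityʳ (O (four+ J) n)))
      O-split Y (suc d) n j≤Y with isOdd (four+ (d ℕ.+ J)) in o
      ... | true = subst₂ _≤_ (sym (G-suc-0 odd-only x n (odd-only-even (suc x) (cong not o))))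
          (cong (λ z → O (four+ J) n + z) (sym (+-identityʳ (odd-terms d (O Y) n)))) (O-split Y d n (ℕ.<⇒≤ j≤Y))
        where x = four+ (d ℕ.+ J)
      ... | false = subst₂ _≤_ (sym (G-suc-1 odd-only x n (odd-only-odd (suc x) (cong not o))))
          (+-assoc (O (four+ J) n) (odd-terms d (O Y) n) _)
          (+-mono-≤ (O-split Y d n (ℕ.<⇒≤ j≤Y)) (sh-mono (suc x ^ k) n (λ i _ →
            subst (λ z → O (suc x) i ≤ O z i) (ℕ.m∸n+n≡m j≤Y) (G-mono-x odd-only-nonNeg (Y ∸ suc x) (suc x) i))))
        where x = four+ (d ℕ.+ J)

      -- Three contributions are each at most p_k(n), whence the 3: partitions with bounded parts,
      -- the constant K from `finite-parts`, and the traded partitions. The constant is covered once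
      -- n ≥ K 2^k.
      odd-rare : ∃[ N ] (∀ n → N ℕ.≤ n → + M * h n n ≤ + 3 * + p k n)
      odd-rare with finite-parts (suc (suc J)) M
      ... | K , le = K ℕ.* 2 ^ k , λ n N≤n →
        let X = four+ (n ℕ.+ J)
            z = suc (suc (n ℕ.+ J))
            n≤X : n ℕ.≤ X
            n≤X = ℕ.≤-trans (ℕ.m≤m+n n J) (ℕ.≤-trans (ℕ.m≤m+n (n ℕ.+ J) 2) (ℕ.≤-trans (ℕ.n≤1+n _) (ℕ.n≤1+n _)))
            A≤ : A (four+ J) n ≤ P X n
            A≤ = ≤-trans (A≤P (four+ J) n) (subst (λ z → P (four+ J) n ≤ P z n) (+-four+ n) (G-mono-x (λ _ → +≥0 1) n (four+ J) n))
        in begin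
          + M * h n n
            ≤⟨ *-monoˡ-≤-nonNeg (+ M) (≤-trans (h≤O X n n≤X) (O-split X n n ℕ.≤-refl)) ⟩
          + M * (O (four+ J) n + odd-terms n (O X) n)
            ≡⟨ *-distribˡ-+ (+ M) (O (four+ J) n) _ ⟩
          + M * O (four+ J) n + + M * odd-terms n (O X) n
            ≤⟨ +-mono-≤ (le n) (odd-terms-bound z n n) ⟩
          (A (four+ J) n + + K) + even-terms (n ℕ.+ J) (A X) n
            ≤⟨ +-mono-≤ (+-mono-≤ A≤ (≤-trans (M≤A z K n N≤n) (A≤P X n)))
                 (≤-trans (even-terms-suc (n ℕ.+ J) (A X) n (A≥0 X)) (even-terms≤P (suc (n ℕ.+ J)) n)) ⟩
          (P X n + P X n) + P X n
            ≡⟨ lem (P X n) ⟩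
          + 3 * P X n
            ≡⟨ cong (+ 3 *_) (p-G X n n≤X) ⟨
          + 3 * + p k n ∎
        where
        open ≤-Reasoning
        lem : ∀ x → (x + x) + x ≡ + 3 * x
        lem = solve-∀
        +-four+ : ∀ n → n ℕ.+ four+ J ≡ four+ (n ℕ.+ J)
        +-four+ n = trans (ℕ.+-suc n (suc J ℕ.+ 2)) (cong suc (trans (ℕ.+-suc n (J ℕ.+ 2)) (cong suc (sym (ℕ.+-assoc n J 2)))))

-- From bounds on natural numbers to rational estimates.

module Rationals where

  open import Defs using (toℚ)
  open import Data.Nat as ℕ using (ℕ; suc; z≤n)
  import Data.Nat.Properties as ℕ
  open import Data.Integer as ℤ using (ℤ; +_; +[1+_]; +≤+)
  import Data.Integer.Properties as ℤ
  open import Data.Rational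
  open import Data.Rational.Properties
  open import Data.Rational.Unnormalised as ℚᵘ using (ℚᵘ; mkℚᵘ)
  import Data.Rational.Unnormalised.Properties as ℚᵘ
  open import Data.Rational.Solver using (module +-*-Solver)
  open import Data.Product using (_,_; ∃-syntax)
  open import Data.Sum using (_⊎_; inj₁; inj₂)
  open import Relation.Binary.PropositionalEquality

  toℚᵘ-toℚ : ∀ n → toℚᵘ (toℚ n) ℚᵘ.≃ mkℚᵘ (+ n) 0
  toℚᵘ-toℚ n = toℚᵘ-fromℚᵘ (mkℚᵘ (+ n) 0)

  toℚ-+ : ∀ m n → toℚ (m ℕ.+ n) ≡ toℚ m + toℚ n
  toℚ-+ m n = toℚᵘ-injective (begin
    toℚᵘ (toℚ (m ℕ.+ n))             ≈⟨ toℚᵘ-toℚ (m ℕ.+ n) ⟩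
    mkℚᵘ (+ (m ℕ.+ n)) 0             ≈⟨ ℚᵘ.*≡* (cong (ℤ._* + 1) (trans (ℤ.pos-+ m n)
                                          (cong₂ ℤ._+_ (sym (ℤ.*-identityʳ (+ m))) (sym (ℤ.*-identityʳ (+ n)))))) ⟩
    mkℚᵘ (+ m) 0 ℚᵘ.+ mkℚᵘ (+ n) 0   ≈⟨ ℚᵘ.+-cong (toℚᵘ-toℚ m) (toℚᵘ-toℚ n) ⟨
    toℚᵘ (toℚ m) ℚᵘ.+ toℚᵘ (toℚ n)   ≈⟨ toℚᵘ-homo-+ (toℚ m) (toℚ n) ⟨
    toℚᵘ (toℚ m + toℚ n)             ∎)
    where open ℚᵘ.≃-Reasoning

  0≤toℚ : ∀ n → 0ℚ ≤ toℚ n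
  0≤toℚ n = toℚᵘ-cancel-≤ (ℚᵘ.≤-respʳ-≃ (ℚᵘ.≃-sym (toℚᵘ-toℚ n)) (ℚᵘ.*≤* (subst (+ 0 ℤ.≤_) (sym (ℤ.*-identityʳ (+ n))) (+≤+ z≤n))))

  ∣toℚ∣ : ∀ n → ∣ toℚ n ∣ ≡ toℚ n
  ∣toℚ∣ n = 0≤p⇒∣p∣≡p (0≤toℚ n)

  -- d is the denominator of ε; a positive numerator gives ε ≥ 1/d.
  toℚ-≤ : ∀ ε → 0ℚ < ε → ∃[ d ] (∀ t z → d ℕ.* t ℕ.≤ z → toℚ t ≤ ε * toℚ z)
  toℚ-≤ ε 0<ε with ε | positive 0<ε
  ... | mkℚ +[1+ m ] d-1 c | _ = suc d-1 , λ t z d*t≤z → toℚᵘ-cancel-≤ (begin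
    toℚᵘ (toℚ t)                          ≃⟨ toℚᵘ-toℚ t ⟩
    mkℚᵘ (+ t) 0                          ≤⟨ ℚᵘ.*≤* (subst₂ ℤ._≤_
       (trans (ℤ.pos-* t (suc d-1)) (cong (λ n → + t ℤ.* + n) (sym (ℕ.*-identityʳ (suc d-1)))))
       (trans (ℤ.pos-* (suc m) z) (sym (ℤ.*-identityʳ (+ suc m ℤ.* + z))))
       (+≤+ (ℕ.≤-trans (ℕ.≤-reflexive (ℕ.*-comm t (suc d-1))) (ℕ.≤-trans d*t≤z (ℕ.m≤m+n z (m ℕ.* z)))))) ⟩
    mkℚᵘ (+ suc m) d-1 ℚᵘ.* mkℚᵘ (+ z) 0  ≃⟨ ℚᵘ.*-congˡ {mkℚᵘ (+ suc m) d-1} (toℚᵘ-toℚ z) ⟨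
    mkℚᵘ (+ suc m) d-1 ℚᵘ.* toℚᵘ (toℚ z)  ≃⟨ toℚᵘ-homo-* (mkℚ +[1+ m ] d-1 c) (toℚ z) ⟨
    toℚᵘ (mkℚ +[1+ m ] d-1 c * toℚ z)     ∎)
    where open ℚᵘ.≤-Reasoning

  toℚ-dist : ∀ x y t → x ≡ y ℕ.+ t ⊎ y ≡ x ℕ.+ t → ∣ toℚ x - toℚ y ∣ ≡ toℚ t
  toℚ-dist x y t (inj₁ refl) = trans (cong ∣_∣ (trans (cong (_- toℚ y) (toℚ-+ y t)) (lem (toℚ y) (toℚ t)))) (∣toℚ∣ t)
    where
    open +-*-Solver
    lem : ∀ y t → (y + t) - y ≡ t
    lem = solve 2 (λ y t → (y :+ t) :- y := t) refl
  toℚ-dist x y t (inj₂ refl) = trans (cong ∣_∣ (trans (cong (λ z → toℚ x - z) (toℚ-+ x t)) (lem (toℚ x) (toℚ t))))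
    (trans (∣-p∣≡∣p∣ (toℚ t)) (∣toℚ∣ t))
    where
    open +-*-Solver
    lem : ∀ x t → x - (x + t) ≡ - t
    lem = solve 2 (λ x t → x :- (x :+ t) := :- t) refl

  toℚ-half : ∀ x y → toℚ x - ½ * toℚ (y ℕ.+ x) ≡ ½ * (toℚ x - toℚ y)
  toℚ-half x y = trans (cong (λ z → toℚ x - ½ * z) (toℚ-+ y x)) (lem (toℚ x) (toℚ y))
    where
    open +-*-Solver
    lem : ∀ x y → x - ½ * (y + x) ≡ ½ * (x - y)
    lem = solve 2 (λ x y → x :- con ½ :* (y :+ x) := con ½ :* (x :- y)) refl

  -- x differs from the mean of x and y by half of x - y, so the factor ½ occurs on both sides.
  half-close : ∀ ε x y t → x ≡ y ℕ.+ t ⊎ y ≡ x ℕ.+ t → toℚ t ≤ ε * toℚ (y ℕ.+ x) →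
               ∣ toℚ x - ½ * toℚ (y ℕ.+ x) ∣ ≤ ε * ∣ ½ * toℚ (y ℕ.+ x) ∣
  half-close ε x y t dist le = begin
    ∣ toℚ x - ½ * toℚ (y ℕ.+ x) ∣  ≡⟨ cong ∣_∣ (toℚ-half x y) ⟩
    ∣ ½ * (toℚ x - toℚ y) ∣        ≡⟨ ∣p*q∣≡∣p∣*∣q∣ ½ (toℚ x - toℚ y) ⟩
    ½ * ∣ toℚ x - toℚ y ∣          ≡⟨ cong (½ *_) (toℚ-dist x y t dist) ⟩
    ½ * toℚ t                      ≤⟨ *-monoˡ-≤-nonNeg ½ le ⟩
    ½ * (ε * toℚ (y ℕ.+ x))        ≡⟨ lem ε (toℚ (y ℕ.+ x)) ⟩
    ε * (½ * toℚ (y ℕ.+ x))        ≡⟨ cong (λ z → ε * (½ * z)) (∣toℚ∣ (y ℕ.+ x)) ⟨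
    ε * (½ * ∣ toℚ (y ℕ.+ x) ∣)    ≡⟨ cong (ε *_) (∣p*q∣≡∣p∣*∣q∣ ½ (toℚ (y ℕ.+ x))) ⟨
    ε * ∣ ½ * toℚ (y ℕ.+ x) ∣      ∎
    where
    open ≤-Reasoning
    open +-*-Solver
    lem : ∀ ε z → ½ * (ε * z) ≡ ε * (½ * z)
    lem = solve 2 (λ ε z → con ½ :* (ε :* z) := ε :* (con ½ :* z)) refl

-- The gap between the two counts: eventually positive, and of smaller order.

module Gap where

  open import Defs using (p; pMod)
  open Series
  open Partitions
  open SignedCount
  open Representation
  open Growth
  open import Data.Bool using (if_then_else_; not)
  open import Data.Nat as ℕ using (ℕ; zero; suc; z≤n; s≤s; _^_; _∸_; _%_; _⊔_)
  import Data.Nat.Properties as ℕ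
  import Data.Nat.Tactic.RingSolver as ℕ-Solver
  open import Data.Integer as ℤ using (+_; 1ℤ; -1ℤ; ∣_∣)
  import Data.Integer.Properties as ℤ
  import Data.Integer.Tactic.RingSolver as ℤ-Solver
  open import Data.Product using (_,_; _×_; ∃-syntax; map₂)
  open import Data.Sum using (_⊎_; inj₁; inj₂)
  open import Relation.Binary.PropositionalEquality hiding (J)

  module Main (k : ℕ) (2≤k : 2 ℕ.≤ k) where

    1≤k : 1 ℕ.≤ k
    1≤k = ℕ.<⇒≤ 2≤k

    open Signed k 1≤k
    module Lg = Large k 2≤k
    open Asymptotics k 2≤k using (odd-rare)

    -- Each multiplicity selects one term of the corresponding geometric sum, and `S-lower` carries
    -- the bound through the factors 2x + 1 and 2x + 2 in turn. Even indices m = 2l start at l = 1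
    -- and odd ones m = 2l + 1 at l = 0, hence the offset of the two ranges.
    h-positive : ∀ x {n₁ n₂} → Rep (_^ k) Lg.T 1 (suc x) n₁ → Rep Lg.odd^ Lg.b 0 x n₂ →
                 1ℤ ℤ.≤ h (double x) (2 ℕ.* Lg.R ℕ.* n₁ ℕ.+ n₂)
    h-positive zero nil nil = subst (λ n → 1ℤ ℤ.≤ δ n) (sym (trans (ℕ.+-identityʳ _) (ℕ.*-zeroʳ (2 ℕ.* Lg.R)))) ℤ.≤-refl
    h-positive (suc x) (snoc {n = n₁} i i≤T r₁) (snoc {n = n₂} j j≤b r₂) =
      subst (λ n → 1ℤ ℤ.≤ h m₂ n) index
        (ℤ.≤-trans (h-positive x r₁ r₂)
          (ℤ.≤-trans (S-lower (e m₁) (L m₁) (h (double x)) (h-nonNeg (double x)) j n₀ j<L)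
            (S-lower (e m₂) (L m₂) (h m₁) (h-nonNeg m₁) i (j ℕ.* e m₁ ℕ.+ n₀) i<L)))
      where
      m₁ = suc (double x)
      m₂ = suc m₁
      n₀ = 2 ℕ.* Lg.R ℕ.* n₁ ℕ.+ n₂
      j<L : j ℕ.< L m₁
      j<L = subst (suc j ℕ.≤_) (trans Lg.sucb (cong (λ o → if not o then 2 ^ k else 2 ^ (k ∸ 1)) (sym (isOdd-double x)))) (s≤s j≤b)
      i<L : i ℕ.< L m₂
      i<L = subst (suc i ℕ.≤_) (trans Lg.sucT (cong (λ o → if o then 2 ^ k else 2 ^ (k ∸ 1)) (sym (isOdd-double (suc x))))) (s≤s i≤T)
      e₁ : e m₁ ≡ Lg.odd^ x
      e₁ = trans (cong (λ o → if not o then m₁ ^ k else 2 ℕ.* m₁ ^ k) (isOdd-double x))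
        (cong (_^ k) (trans (cong suc (double≡2* x)) (ℕ.+-comm 1 (2 ℕ.* x))))
      e₂ : e m₂ ≡ 2 ℕ.* (Lg.R ℕ.* suc x ^ k)
      e₂ = trans (cong (λ o → if o then m₂ ^ k else 2 ℕ.* m₂ ^ k) (isOdd-double (suc x)))
        (cong (2 ℕ.*_) (trans (cong (_^ k) (double≡2* (suc x))) (^-distribʳ-* k 2 (suc x))))
      index : i ℕ.* e m₂ ℕ.+ (j ℕ.* e m₁ ℕ.+ n₀) ≡ 2 ℕ.* Lg.R ℕ.* (i ℕ.* suc x ^ k ℕ.+ n₁) ℕ.+ (j ℕ.* Lg.odd^ x ℕ.+ n₂)
      index = trans (cong₂ (λ u v → i ℕ.* v ℕ.+ (j ℕ.* u ℕ.+ n₀)) e₁ e₂) (lem i j Lg.R (suc x ^ k) (Lg.odd^ x) n₁ n₂)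
        where
        lem : ∀ i j r x y m n → i ℕ.* (2 ℕ.* (r ℕ.* x)) ℕ.+ (j ℕ.* y ℕ.+ (2 ℕ.* r ℕ.* m ℕ.+ n))
              ≡ 2 ℕ.* r ℕ.* (i ℕ.* x ℕ.+ m) ℕ.+ (j ℕ.* y ℕ.+ n)
        lem = ℕ-Solver.solve-∀

    h-stable : ∀ x n → n ℕ.≤ x → h x n ≡ h n n
    h-stable x n n≤x = trans (sym (D≡h x n n≤x)) (D≡h′ (double x) n (ℕ.≤-trans n≤x (n≤double x)))

    represented-positive : ∀ H hi n → Lg.Represented H hi n → 1ℤ ℤ.≤ h n n
    represented-positive H hi n rep = subst (1ℤ ℤ.≤_) (h-stable (double x) n (ℕ.≤-trans (ℕ.m≤n⊔m (H ⊔ hi) n) (n≤double x)))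
      (subst (λ i → 1ℤ ℤ.≤ h (double x) i) (sym sum) (h-positive x
        (Rep-extendˡ 1≤x₀ (Rep-pad-≤ (ℕ.m≤n⇒m≤1+n (ℕ.≤-trans (ℕ.m≤m⊔n H hi) (ℕ.m≤m⊔n (H ⊔ hi) n))) evens))
        (Rep-pad-≤ (ℕ.≤-trans (ℕ.m≤n⊔m H hi) (ℕ.m≤m⊔n (H ⊔ hi) n)) odds)))
      where
      open Lg.Represented rep
      -- A common bound to which both representations are padded; x ≥ n makes the coefficient
      -- stable.
      x = H ⊔ hi ⊔ n
      1≤x₀ : 1 ℕ.≤ Lg.x₀
      1≤x₀ = ℕ.*-mono-≤ {1} {3} (s≤s z≤n) (ℕ.m^n>0 2 k)

    h-eventually-positive : ∃[ N ] (∀ n → N ℕ.≤ n → 1ℤ ℤ.≤ h n n)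
    h-eventually-positive = from Lg.all-large
      where
      from : ∃[ H ] ∃[ u ] (∀ n → u ℕ.≤ n → ∃[ hi ] Lg.Represented H hi n) → ∃[ N ] (∀ n → N ℕ.≤ n → 1ℤ ℤ.≤ h n n)
      from (H , u , reps) = u , λ n u≤n → let hi , rep = reps n u≤n in represented-positive H hi n rep

    private
      i-j≡k⇒i≡j+k : ∀ {i j k} → i ℤ.- j ≡ k → i ≡ j ℤ.+ k
      i-j≡k⇒i≡j+k {i} {j} e = trans (lem i j) (cong (λ z → j ℤ.+ z) e)
        where
        lem : ∀ i j → i ≡ j ℤ.+ (i ℤ.- j)
        lem = ℤ-Solver.solve-∀

      i-j≡-k⇒j≡i+k : ∀ {i j k} → i ℤ.- j ≡ -1ℤ ℤ.* k → j ≡ i ℤ.+ k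
      i-j≡-k⇒j≡i+k {i} {j} {k} e = trans (lem₁ i j) (trans (cong (λ z → i ℤ.- z) e) (lem₂ i k))
        where
        lem₁ : ∀ i j → j ≡ i ℤ.- (i ℤ.- j)
        lem₁ = ℤ-Solver.solve-∀
        lem₂ : ∀ i k → i ℤ.- -1ℤ ℤ.* k ≡ i ℤ.+ k
        lem₂ = ℤ-Solver.solve-∀

    gap : ℕ → ℕ
    gap n = ∣ h n n ∣

    +gap : ∀ n → + gap n ≡ h n n
    +gap n = ℤ.0≤i⇒+∣i∣≡i (h-nonNeg n n)

    pMod-gap : ∀ n → (n % 2 ≡ 0 × pMod k 0 2 n ≡ pMod k 1 2 n ℕ.+ gap n)
                   ⊎ (n % 2 ≡ 1 × pMod k 1 2 n ≡ pMod k 0 2 n ℕ.+ gap n)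
    pMod-gap n with parity n | pMod-pMod-h n n ℕ.≤-refl
    ... | inj₁ (even , s) | eq = inj₁ (even , ℤ.+-injective (i-j≡k⇒i≡j+k {+ pMod k 0 2 n} {+ pMod k 1 2 n} (trans eq
          (trans (cong (ℤ._* h n n) s) (trans (ℤ.*-identityˡ (h n n)) (sym (+gap n)))))))
    ... | inj₂ (odd , s) | eq = inj₂ (odd , ℤ.+-injective (i-j≡-k⇒j≡i+k {+ pMod k 0 2 n} {+ pMod k 1 2 n} (trans eq
          (cong₂ ℤ._*_ s (sym (+gap n))))))

    gap-positive : ∃[ N ] (∀ n → N ℕ.≤ n → 1 ℕ.≤ gap n)
    gap-positive = map₂ (λ pos n N≤n → ℤ.drop‿+≤+ (subst (1ℤ ℤ.≤_) (sym (+gap n)) (pos n N≤n))) h-eventually-positive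

    gap-rare : ∀ M → ∃[ N ] (∀ n → N ℕ.≤ n → M ℕ.* gap n ℕ.≤ 3 ℕ.* p k n)
    gap-rare M = map₂ (λ rare n N≤n → ℤ.drop‿+≤+ (subst₂ ℤ._≤_
      (trans (cong (+ M ℤ.*_) (sym (+gap n))) (sym (ℤ.pos-* M (gap n)))) (sym (ℤ.pos-* 3 (p k n))) (rare n N≤n))) (odd-rare M)

    -- With a, b the even and odd counts and t the gap, p = a + b ≤ 2b + t for either parity of n.
    -- Then (6d + 3) t ≤ 3p ≤ 6b + 3t leaves d t ≤ b, which explains the constant 6d + 3.
    gap-small : ∀ d → ∃[ N ] (∀ n → N ℕ.≤ n → d ℕ.* gap n ℕ.≤ pMod k 1 2 n)
    gap-small d = map₂ (λ rare n N≤n →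
      let a = pMod k 0 2 n
          b = pMod k 1 2 n
          t = gap n
      in ℕ.*-cancelˡ-≤ 6 (ℕ.+-cancelʳ-≤ (3 ℕ.* t) (6 ℕ.* (d ℕ.* t)) (6 ℕ.* b)
        (subst (ℕ._≤ 6 ℕ.* b ℕ.+ 3 ℕ.* t) (lem₁ d t)
          (ℕ.≤-trans (rare n N≤n) (subst₂ ℕ._≤_ (cong (3 ℕ.*_) (sym (p≡pMod+pMod n))) (lem₂ b t)
            (ℕ.*-monoʳ-≤ 3 (ℕ.+-monoˡ-≤ b (a≤b+t n)))))))) (gap-rare (6 ℕ.* d ℕ.+ 3))
      where
      a≤b+t : ∀ n → pMod k 0 2 n ℕ.≤ pMod k 1 2 n ℕ.+ gap n
      a≤b+t n with pMod-gap n
      ... | inj₁ (_ , eq) = ℕ.≤-reflexive eq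
      ... | inj₂ (_ , eq) = ℕ.≤-trans (ℕ.m≤m+n _ (gap n)) (ℕ.≤-trans (ℕ.≤-reflexive (sym eq)) (ℕ.m≤m+n _ (gap n)))
      lem₁ : ∀ d t → (6 ℕ.* d ℕ.+ 3) ℕ.* t ≡ 6 ℕ.* (d ℕ.* t) ℕ.+ 3 ℕ.* t
      lem₁ = ℕ-Solver.solve-∀
      lem₂ : ∀ b t → 3 ℕ.* (b ℕ.+ t ℕ.+ b) ≡ 6 ℕ.* b ℕ.+ 3 ℕ.* t
      lem₂ = ℕ-Solver.solve-∀

-- Asymptotic equivalence and the eventual strict inequalities.

module Comparison where

  open import Defs using (p; pMod; toℚ; _∼_)
  open SignedCount
  open Gap
  open Rationals
  open import Data.Nat using (ℕ; _+_; _≤_; _<_; _%_)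
  open import Data.Nat.Properties
  open import Data.Rational as ℚ using (ℚ; ½)
  open import Data.Product using (_,_; _×_; ∃-syntax; map₂)
  open import Data.Sum using (_⊎_; inj₁; inj₂; swap)
  open import Data.Empty using (⊥-elim)
  open import Relation.Binary.PropositionalEquality

  module At (k : ℕ) (2≤k : 2 ≤ k) where

    open Main k 2≤k
    open Signed k 1≤k using (p≡pMod+pMod)

    gap-dist : ∀ n → pMod k 0 2 n ≡ pMod k 1 2 n + gap n ⊎ pMod k 1 2 n ≡ pMod k 0 2 n + gap n
    gap-dist n with pMod-gap n
    ... | inj₁ (_ , eq) = inj₁ eq
    ... | inj₂ (_ , eq) = inj₂ eq

    even∼odd : (λ n → toℚ (pMod k 0 2 n)) ∼ (λ n → toℚ (pMod k 1 2 n))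
    even∼odd ε 0<ε = let d , bound = toℚ-≤ ε 0<ε in map₂ (λ small n N≤n → subst₂ ℚ._≤_
      (sym (toℚ-dist (pMod k 0 2 n) (pMod k 1 2 n) (gap n) (gap-dist n)))
      (cong (ε ℚ.*_) (sym (∣toℚ∣ (pMod k 1 2 n))))
      (bound (gap n) (pMod k 1 2 n) (small n N≤n))) (gap-small d)

    odd∼half : (λ n → toℚ (pMod k 1 2 n)) ∼ (λ n → ½ ℚ.* toℚ (p k n))
    odd∼half ε 0<ε = let d , bound = toℚ-≤ ε 0<ε in map₂ (λ small n N≤n →
      subst (λ s → ℚ.∣ toℚ (pMod k 1 2 n) ℚ.- ½ ℚ.* toℚ s ∣ ℚ.≤ ε ℚ.* ℚ.∣ ½ ℚ.* toℚ s ∣) (sym (p≡pMod+pMod n))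
        (half-close ε (pMod k 1 2 n) (pMod k 0 2 n) (gap n) (swap (gap-dist n))
          (bound (gap n) (pMod k 0 2 n + pMod k 1 2 n)
            (≤-trans (small n N≤n) (m≤n+m (pMod k 1 2 n) (pMod k 0 2 n)))))) (gap-small d)

    comparison : ∃[ N ] (∀ n → N ≤ n →
      (n % 2 ≡ 0 → pMod k 1 2 n < pMod k 0 2 n) × (n % 2 ≡ 1 → pMod k 0 2 n < pMod k 1 2 n))
    comparison = map₂ (λ pos n N≤n → strict n (pos n N≤n)) gap-positive
      where
      below : ∀ {x y t} → 1 ≤ t → x ≡ y + t → y < x
      below {y = y} {t} 1≤t refl = subst (_≤ y + t) (+-comm y 1) (+-monoʳ-≤ y 1≤t)
      strict : ∀ n → 1 ≤ gap n → (n % 2 ≡ 0 → pMod k 1 2 n < pMod k 0 2 n) × (n % 2 ≡ 1 → pMod k 0 2 n < pMod k 1 2 n)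
      strict n 1≤gap with pMod-gap n
      ... | inj₁ (even , eq) = (λ _ → below 1≤gap eq) , λ odd → ⊥-elim (0≢1+n (trans (sym even) odd))
      ... | inj₂ (odd , eq) = (λ even → ⊥-elim (0≢1+n (trans (sym even) odd))) , λ _ → below 1≤gap eq

open import Defs
open import Data.Nat using (ℕ; _≤_; _<_; _%_)
open import Data.Rational using (_*_; ½)
open import Data.Product using (_,_; _×_; ∃-syntax)
open import Relation.Binary.PropositionalEquality using (_≡_)

theorem2 : ∀ (k : ℕ) → 2 ≤ k →
    ((λ n → toℚ (pMod k 0 2 n)) ∼ (λ n → toℚ (pMod k 1 2 n)))
    × ((λ n → toℚ (pMod k 1 2 n)) ∼ (λ n → ½ * toℚ (p k n)))
    × (∃[ N ] (∀ n → N ≤ n →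
    (n % 2 ≡ 0 → pMod k 1 2 n < pMod k 0 2 n)
    × (n % 2 ≡ 1 → pMod k 0 2 n < pMod k 1 2 n)))
theorem2 k 2≤k = even∼odd , odd∼half , comparison
  where open Comparison.At k 2≤k
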